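{- Each of the parameterized problems \textsc{Hamiltonian Cycle}[$\#v,\deg(v)\neq 2$] and \textsc{Hamiltonian Path}[$\#v,\deg(v)\neq 2$] admits a polynomial boundaried kernelization whose output graph has $\mathcal{O}(|B|+k)$ vertices, where $B$ is the boundary of the input boundaried graph $G_B$ and $k$ is the value of the given parameter solution, i.e., the size of a given set $X\subseteq V(G)$ such that every vertex of $V(G)\setminus X$ has degree exactly $2$ in $G$.
   Context: A boundaried graph $G_B$ is a finite simple graph $G$ together with a set $B\subseteq V(G)$ (the boundary). For boundaried graphs $G_B$ and $H_C$ with $V(G)\cap V(H)\subseteq B\cap C$, the gluing $G_B\oplus H_C$ is the simple graph obtained from the disjoint union of $G$ and $H$ by identifying each vertex of $B\cap C$ in $G$ with the identically named vertex in $H$ (an edge present in both is kept once). For a decision problem $\Pi$ (an isomorphism-closed class of graphs), two $B$-boundaried graphs $G_B,G'_B$ are gluing equivalent w.r.t. $\Pi$ and $B$, written $G_B\equiv_{\Pi,B}G'_B$, if for every boundaried graph $H_B$ we have $G_B\oplus H_B\in\Pi\iff G'_B\oplus H_B\in\Pi$. For a pure graph minimization problem $\rho$ (isomorphism-invariant), a $\rho$-solution of $G$ is a feasible solution $s$ of $\rho$ on $G$, with value $\rho(G,s)$. For computable $f$, a boundaried kernelization of size $f$ for a decision problem $\Pi[\rho]$ is a polynomial-time algorithm that, given a boundaried graph $G_B$ and a $\rho$-solution $s$ of $G$, outputs a boundaried graph $G'_B$ with $G_B\equiv_{\Pi,B}G'_B$ and a $\rho$-solution $s'$ of $G'$ such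 that $|G'|,|s'|,\rho(G',s')\le f(|B|+\rho(G,s))$ (here $|\cdot|$ is encoding size). It is polynomial if $f$ is bounded by a polynomial. \textsc{Hamiltonian Cycle} (resp. \textsc{Hamiltonian Path}) asks whether $G$ has a cycle (resp. path) visiting every vertex exactly once. The minimization problem $\#v,\deg(v)\neq 2$ has as feasible solutions on $G$ the sets $S\subseteq V(G)$ such that all vertices in $V(G)\setminus S$ have degree exactly two, with value $|S|$; it is used as $\rho$. -}

module Defs where

open import Data.List.Base using (List; []; _∷_; _∷ʳ_; _++_; length; filter)
open import Data.List.Membership.Propositional using (_∈_; _∉_)
open import Data.List.Membership.Propositional.Properties
  using (∈-++⁺ˡ; ∈-++⁺ʳ; ∈-filter⁺)
import Data.List.Membership.DecPropositional as DecMembership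
open import Data.List.Relation.Binary.Permutation.Propositional using (_↭_)
open import Data.List.Relation.Unary.All as All using (All)
import Data.List.Relation.Unary.All.Properties as All
open import Data.List.Relation.Unary.AllPairs using (AllPairs)
import Data.List.Relation.Unary.AllPairs.Properties as AllPairs
open import Data.List.Relation.Unary.Any as Any using (Any)
import Data.List.Relation.Unary.Any.Properties as Any
open import Data.List.Relation.Unary.Linked using (Linked)
open import Data.List.Relation.Unary.Unique.Propositional using (Unique)
open import Data.Nat.Base using (ℕ; zero; suc; _+_; _*_; _^_; _≤_)
open import Data.Nat.Binary.Base using (ℕᵇ; fromℕ; 2[1+_]; 1+[2_])
open import Data.Nat.Logarithm using (⌈log₂_⌉)
open import Data.Nat.Properties using (_≟_)
open import Data.Product.Base using (∃-syntax; _×_; _,_; proj₁; proj₂; swap)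
open import Data.Product.Properties using (≡-dec)
open import Data.Sum.Base using (_⊎_; inj₁; inj₂)
open import Function.Bundles using (_⇔_)
open import Relation.Binary.PropositionalEquality using (_≡_; _≢_; refl)
open import Relation.Nullary using (¬_; Dec; yes; no)
open import Relation.Nullary.Decidable using (_⊎-dec_; ¬?)

------------------------------------------------------------------------
-- Finite simple graphs, with vertices named by natural numbers

Vertex : Set
Vertex = ℕ

record FinSet : Set where
  constructor finSet
  field
    elements : List Vertex
    distinct : Unique elements

open FinSet public

infix 4 _∈ˢ_ _∉ˢ_ _⊆ˢ_

_∈ˢ_ _∉ˢ_ : Vertex → FinSet → Set
v ∈ˢ A = v ∈ elements A
v ∉ˢ A = v ∉ elements A

_⊆ˢ_ : FinSet → FinSet → Set
A ⊆ˢ B = ∀ {v} → v ∈ˢ A → v ∈ˢ B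

∣_∣ : FinSet → ℕ
∣ A ∣ = length (elements A)

open DecMembership _≟_ using (_∈?_)

-- A pair (x , y) stands for the unordered edge {x, y}.
Edge : Set
Edge = Vertex × Vertex

infix 4 _≈ᵉ_ _≈ᵉ?_

_≈ᵉ_ : Edge → Edge → Set
e ≈ᵉ f = e ≡ f ⊎ e ≡ swap f

_≈ᵉ?_ : ∀ e f → Dec (e ≈ᵉ f)
e ≈ᵉ? f = ≡-dec _≟_ _≟_ e f ⊎-dec ≡-dec _≟_ _≟_ e (swap f)

≈ᵉ-sym : ∀ {e f} → e ≈ᵉ f → f ≈ᵉ e
≈ᵉ-sym (inj₁ refl) = inj₁ refl
≈ᵉ-sym (inj₂ refl) = inj₂ refl

-- Each edge is listed once, in one of its two orientations.
record Graph : Set where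
  field
    vertices  : FinSet
    edges     : List Edge
    endpoints : All (λ e → proj₁ e ∈ˢ vertices × proj₂ e ∈ˢ vertices) edges
    loopless  : All (λ e → proj₁ e ≢ proj₂ e) edges
    once      : AllPairs (λ e f → ¬ (e ≈ᵉ f)) edges

open Graph public

Adjacent : Graph → Vertex → Vertex → Set
Adjacent G u v = Any ((u , v) ≈ᵉ_) (edges G)

Incident : Vertex → Edge → Set
Incident v e = v ≡ proj₁ e ⊎ v ≡ proj₂ e

incident? : ∀ v e → Dec (Incident v e)
incident? v e = (v ≟ proj₁ e) ⊎-dec (v ≟ proj₂ e)

degree : Graph → Vertex → ℕ
degree G v = length (filter (incident? v) (edges G))

------------------------------------------------------------------------
-- Boundaried graphs and gluing

record Boundaried (B : FinSet) : Set where
  field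
    graph    : Graph
    boundary : B ⊆ˢ vertices graph

open Boundaried public

_∪ˢ_ : FinSet → FinSet → FinSet
A ∪ˢ B = finSet (elements A ++ filter new? (elements B))
  (AllPairs.++⁺ (distinct A) (AllPairs.filter⁺ new? (distinct B))
    (All.tabulate λ {x} x∈A →
      All.map (λ {y} y∉A x≡y → y∉A (subst∈ x≡y x∈A))
              (All.all-filter new? (elements B))))
  where
  new? = λ v → ¬? (v ∈? elements A)
  subst∈ : ∀ {x y} → x ≡ y → x ∈ˢ A → y ∈ˢ A
  subst∈ refl x∈A = x∈A

⊆-∪ˡ : ∀ A B → A ⊆ˢ A ∪ˢ B
⊆-∪ˡ A B = ∈-++⁺ˡ

⊆-∪ʳ : ∀ A B → B ⊆ˢ A ∪ˢ B
⊆-∪ʳ A B {v} v∈B with v ∈? elements A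
... | yes v∈A = ∈-++⁺ˡ v∈A
... | no  v∉A = ∈-++⁺ʳ (elements A)
                  (∈-filter⁺ (λ u → ¬? (u ∈? elements A)) v∈B v∉A)

_∪ᵍ_ : Graph → Graph → Graph
G ∪ᵍ H = record
  { vertices  = V
  ; edges     = edges G ++ filter new? (edges H)
  ; endpoints = All.++⁺
      (All.map (λ (p , q) → ⊆-∪ˡ VG VH p , ⊆-∪ˡ VG VH q) (endpoints G))
      (All.filter⁺ new?
        (All.map (λ (p , q) → ⊆-∪ʳ VG VH p , ⊆-∪ʳ VG VH q) (endpoints H)))
  ; loopless  = All.++⁺ (loopless G) (All.filter⁺ new? (loopless H))
  ; once      = AllPairs.++⁺ (once G) (AllPairs.filter⁺ new? (once H))
      (All.tabulate λ {e} e∈G →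
        All.map (λ {f} f-new e≈f → f-new (Any.map (λ { refl → ≈ᵉ-sym e≈f }) e∈G))
                (All.all-filter new? (edges H)))
  }
  where
  VG = vertices G
  VH = vertices H
  V  = VG ∪ˢ VH
  new? = λ e → ¬? (Any.any? (e ≈ᵉ?_) (edges G))

-- V(G) ∩ V(H) ⊆ B ∩ C
Gluable : ∀ {B C} → Boundaried B → Boundaried C → Set
Gluable {B} {C} G H =
  ∀ {v} → v ∈ˢ vertices (graph G) → v ∈ˢ vertices (graph H) → v ∈ˢ B × v ∈ˢ C

-- Vertices are identified exactly when they have the same name, so for
-- gluable graphs the gluing is the union.
glue : ∀ {B C} (G : Boundaried B) (H : Boundaried C) → .(Gluable G H) → Graph
glue G H _ = graph G ∪ᵍ graph H

Problem : Set₁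
Problem = Graph → Set

-- H ranges over the B-boundaried graphs for which both gluings are
-- defined, i.e. which share no non-boundary vertex name with G or G'.
GluingEquivalent : Problem → (B : FinSet) → Boundaried B → Boundaried B → Set
GluingEquivalent Π B G G' =
  ∀ (H : Boundaried B) (g : Gluable G H) (g' : Gluable G' H) →
  Π (glue G H g) ⇔ Π (glue G' H g')

------------------------------------------------------------------------
-- Hamiltonian cycles and paths

-- v₁, …, vₙ enumerates the vertices, n ≥ 3, and v₁ v₂ … vₙ v₁ is a walk.
HamiltonianCycle : Problem
HamiltonianCycle G =
  ∃[ v ] ∃[ vs ] ((v ∷ vs) ↭ elements (vertices G))
               × Linked (Adjacent G) ((v ∷ vs) ∷ʳ v)
               × 3 ≤ length (v ∷ vs)

-- Paths are nonempty.
HamiltonianPath : Problem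
HamiltonianPath G =
  ∃[ v ] ∃[ vs ] ((v ∷ vs) ↭ elements (vertices G))
               × Linked (Adjacent G) (v ∷ vs)

------------------------------------------------------------------------
-- A WHILE language over binary trees (after Jones, "Computability and
-- Complexity from a Programming Perspective"), in point-free form: a
-- program denotes a partial function from trees to trees

data Tree : Set where
  nil : Tree
  _·_ : Tree → Tree → Tree

infixr 5 _·_

size : Tree → ℕ
size nil     = 1
size (a · b) = suc (size a + size b)

data Program : Set where
  id nil hd tl : Program
  _⨾_          : Program → Program → Program
  cons equal   : Program → Program → Program
  if_then_else_ : Program → Program → Program → Program
  while_loop_  : Program → Program → Program

infixr 6 _⨾_

infix 4 _⊢_⇓_∣_

-- p ⊢ x ⇓ y ∣ n : on input x, program p halts with output y in n steps.
-- As in Lisp, nil is false and every other tree is true. Pairing costs one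
-- step since trees can be shared, whereas comparison pays for traversing
-- both of its arguments.
data _⊢_⇓_∣_ : Program → Tree → Tree → ℕ → Set where
  id      : ∀ {x} → id ⊢ x ⇓ x ∣ 1
  nil     : ∀ {x} → nil ⊢ x ⇓ nil ∣ 1
  hd-nil  : hd ⊢ nil ⇓ nil ∣ 1
  hd-cons : ∀ {a b} → hd ⊢ a · b ⇓ a ∣ 1
  tl-nil  : tl ⊢ nil ⇓ nil ∣ 1
  tl-cons : ∀ {a b} → tl ⊢ a · b ⇓ b ∣ 1
  seq     : ∀ {p q x y z m n} →
            p ⊢ x ⇓ y ∣ m → q ⊢ y ⇓ z ∣ n → p ⨾ q ⊢ x ⇓ z ∣ 1 + m + n
  cons    : ∀ {p q x a b m n} →
            p ⊢ x ⇓ a ∣ m → q ⊢ x ⇓ b ∣ n → cons p q ⊢ x ⇓ a · b ∣ 1 + m + n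
  equal-yes : ∀ {p q x a m n} →
            p ⊢ x ⇓ a ∣ m → q ⊢ x ⇓ a ∣ n →
            equal p q ⊢ x ⇓ nil · nil ∣ 1 + m + n + size a + size a
  equal-no  : ∀ {p q x a b m n} →
            p ⊢ x ⇓ a ∣ m → q ⊢ x ⇓ b ∣ n → a ≢ b →
            equal p q ⊢ x ⇓ nil ∣ 1 + m + n + size a + size b
  if-true  : ∀ {p q r x a b y m n} →
            p ⊢ x ⇓ a · b ∣ m → q ⊢ x ⇓ y ∣ n →
            if p then q else r ⊢ x ⇓ y ∣ 1 + m + n
  if-false : ∀ {p q r x y m n} →
            p ⊢ x ⇓ nil ∣ m → r ⊢ x ⇓ y ∣ n →
            if p then q else r ⊢ x ⇓ y ∣ 1 + m + n
  while-done : ∀ {p q x m} →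
            p ⊢ x ⇓ nil ∣ m → while p loop q ⊢ x ⇓ x ∣ 1 + m
  while-step : ∀ {p q x a b y z l m n} →
            p ⊢ x ⇓ a · b ∣ l → q ⊢ x ⇓ y ∣ m → while p loop q ⊢ y ⇓ z ∣ n →
            while p loop q ⊢ x ⇓ z ∣ 1 + l + m + n

unary : ℕ → Tree
unary zero    = nil
unary (suc n) = nil · unary n

Computable : (ℕ → ℕ) → Set
Computable f = ∃[ p ] ∀ n → ∃[ t ] (p ⊢ unary n ⇓ unary (f n) ∣ t)

PolynomiallyBounded : (ℕ → ℕ) → Set
PolynomiallyBounded f = ∃[ c ] ∃[ d ] ∀ n → f n ≤ c * n ^ d + c

------------------------------------------------------------------------
-- Encodings and encoding sizes

-- Digits of the bijective base-2 representation.
encodeᵇ : ℕᵇ → Tree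
encodeᵇ ℕᵇ.zero  = nil
encodeᵇ 2[1+ n ] = nil · encodeᵇ n
encodeᵇ 1+[2 n ] = (nil · nil) · encodeᵇ n

encodeVertex : Vertex → Tree
encodeVertex v = encodeᵇ (fromℕ v)

encodeList : ∀ {A : Set} → (A → Tree) → List A → Tree
encodeList enc []       = nil
encodeList enc (x ∷ xs) = enc x · encodeList enc xs

encodeSet : FinSet → Tree
encodeSet A = encodeList encodeVertex (elements A)

encodeEdge : Edge → Tree
encodeEdge (u , v) = encodeVertex u · encodeVertex v

encodeGraph : Graph → Tree
encodeGraph G = encodeSet (vertices G) · encodeList encodeEdge (edges G)

-- The encoding sizes that a kernelization has to bound count
-- 1 + ⌈log₂ n⌉ bits for each occurrence of a vertex of an n-vertex graph.
-- They disregard the length of the actual names: G' must keep the names of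
-- the boundary vertices, and these are arbitrarily long compared to ∣ B ∣.
vertexBits : Graph → ℕ
vertexBits G = 1 + ⌈log₂ ∣ vertices G ∣ ⌉

graphSize : Graph → ℕ
graphSize G = (∣ vertices G ∣ + 2 * length (edges G)) * vertexBits G

subsetSize : Graph → FinSet → ℕ
subsetSize G S = ∣ S ∣ * vertexBits G

------------------------------------------------------------------------
-- Parameters given by graph minimization problems

record MinimizationProblem : Set₁ where
  field
    Solution       : Graph → Set
    value          : ∀ {G} → Solution G → ℕ
    encodeSolution : ∀ {G} → Solution G → Tree
    solutionSize   : ∀ {G} → Solution G → ℕ

open MinimizationProblem public

record DegreeTwoOutside (G : Graph) : Set where
  field
    set       : FinSet
    subset    : set ⊆ˢ vertices G
    degreeTwo : ∀ {v} → v ∈ˢ vertices G → v ∉ˢ set → degree G v ≡ 2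

open DegreeTwoOutside public

#v,deg≢2 : MinimizationProblem
#v,deg≢2 = record
  { Solution       = DegreeTwoOutside
  ; value          = λ s → ∣ set s ∣
  ; encodeSolution = λ s → encodeSet (set s)
  ; solutionSize   = λ {G} s → subsetSize G (set s)
  }

------------------------------------------------------------------------
-- Boundaried kernelization

module _ (ρ : MinimizationProblem) where

  encodeInstance : ∀ B (G : Boundaried B) → Solution ρ (graph G) → Tree
  encodeInstance B G s =
    encodeSet B · encodeGraph (graph G) · encodeSolution ρ s

  record BoundariedKernelization (Π : Problem) (f : ℕ → ℕ) : Set where
    field
      size-computable : Computable f
      algorithm       : Program
      time            : ℕ → ℕ
      time-polynomial : PolynomiallyBounded time

      output   : ∀ {B} (G : Boundaried B) → Solution ρ (graph G) → Boundaried B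
      solution : ∀ {B} (G : Boundaried B) (s : Solution ρ (graph G)) →
                 Solution ρ (graph (output G s))

      -- Writing down the output, without sharing, is part of the running time.
      computes : ∀ {B} (G : Boundaried B) (s : Solution ρ (graph G)) →
        let input  = encodeInstance B G s
            result = encodeInstance B (output G s) (solution G s)
        in ∃[ t ] (algorithm ⊢ input ⇓ result ∣ t)
                × t + size result ≤ time (size input)

      equivalent : ∀ {B} (G : Boundaried B) (s : Solution ρ (graph G)) →
        GluingEquivalent Π B G (output G s)

      graph-bound    : ∀ {B} (G : Boundaried B) (s : Solution ρ (graph G)) →
        graphSize (graph (output G s)) ≤ f (∣ B ∣ + value ρ s)
      solution-bound : ∀ {B} (G : Boundaried B) (s : Solution ρ (graph G)) →
        solutionSize ρ (solution G s) ≤ f (∣ B ∣ + value ρ s)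
      value-bound    : ∀ {B} (G : Boundaried B) (s : Solution ρ (graph G)) →
        value ρ (solution G s) ≤ f (∣ B ∣ + value ρ s)

  open BoundariedKernelization public

  -- The additive constant is only relevant for ∣ B ∣ + k = 0.
  LinearlyManyVertices : ∀ {Π f} → BoundariedKernelization Π f → Set
  LinearlyManyVertices K =
    ∃[ c ] ∀ {B} (G : Boundaried B) (s : Solution ρ (graph G)) →
    ∣ vertices (graph (output K G s)) ∣ ≤ c * (∣ B ∣ + value ρ s) + c

{-# OPTIONS --safe #-}
module Submission where

-- Let P = X ∪ B, so that every vertex outside P has degree two and keeps its
-- neighbourhood in every gluing. If v, u, w are outside P, u and w are the
-- neighbours of v, and u and w are not adjacent, then deleting v and joining u
-- to w changes neither Hamiltonicity nor traceability of any gluing: a cycle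
-- must use the edge u w since u has degree two, and a path avoiding it has an
-- end in u, to which v can be attached. When no such v is left, a Hamiltonian
-- path of a gluing cannot contain three consecutive vertices outside P, unless
-- these form a triangle and are the whole path. Hence there are at most
-- 2 |P| + 3 vertices outside P, or the answer is no in every gluing. In the
-- latter case, the kernel consists of the boundary and two isolated vertices.

open import Defs
open import Data.Bool.Base using (Bool; true; false; not; _∧_; _∨_) renaming (if_then_else_ to when_then_else_)
open import Data.Empty using (⊥; ⊥-elim)
open import Data.List.Base using (List; []; _∷_; _++_; _∷ʳ_; _ʳ++_; length; filter; foldr; drop; map; replicate; reverse; cartesianProduct; InitLast; initLast; _∷ʳ′_)
import Data.List.Membership.DecPropositional as DecMembership
open import Data.List.Membership.Propositional using (_∈_; _∉_; find; lose)
open import Data.List.Membership.Propositional.Properties using (∈-∃++; ∈-++⁺ˡ; ∈-++⁺ʳ; ∈-++⁻; ∈-filter⁺; ∈-filter⁻; ∈-cartesianProduct⁺)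
open import Data.List.Membership.Propositional.Properties.WithK using (unique∧set⇒bag)
open import Data.List.Properties using (++-assoc; length-++; length-map; length-drop; length-replicate; length-reverse; drop-drop; reverse-involutive; filter-accept; filter-reject; filter-++; filter-notAll)
open import Data.List.Relation.Binary.BagAndSetEquality using (∼bag⇒↭)
open import Data.List.Relation.Binary.Permutation.Propositional using (_↭_; ↭-sym; ↭-trans; ↭-refl; ↭-reflexive; ↭-swap; prep; ↭⇒↭ₛ)
open import Data.List.Relation.Binary.Permutation.Propositional.Properties using (shift; ++-comm; ∈-resp-↭; drop-mid; drop-∷; ↭-length)
open import Data.List.Relation.Binary.Permutation.Setoid.Properties using (Unique-resp-↭)
open import Data.List.Relation.Unary.All as All using (All; []; _∷_)
import Data.List.Relation.Unary.All.Properties as All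
open import Data.List.Relation.Unary.AllPairs as AllPairs using (AllPairs; []; _∷_)
import Data.List.Relation.Unary.AllPairs.Properties as AllPairs
open import Data.List.Relation.Unary.Any as Any using (Any; any?; here; there)
import Data.List.Relation.Unary.Any.Properties as Any
open import Data.List.Relation.Unary.Linked using (Linked; []; [-]; _∷_; tail)
open import Data.List.Relation.Unary.Unique.Propositional using (Unique)
import Data.List.Relation.Unary.Unique.Propositional.Properties as Unique
open import Data.Nat.Base using (ℕ; zero; suc; _+_; _*_; _^_; _∸_; _≤_; z≤n; s≤s)
open import Data.Nat.Binary.Base using (ℕᵇ; 2[1+_]; 1+[2_])
open import Data.Nat.Binary.Properties using (fromℕ-injective)
open import Data.Nat.Logarithm using (⌈log₂_⌉; ⌈log₂⌉-mono-≤; ⌈log₂2^n⌉≡n)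
open import Data.Nat.Properties
open import Data.Nat.Tactic.RingSolver using (solve-∀)
open import Data.Product.Base using (∃-syntax; Σ-syntax; _×_; _,_; proj₁; proj₂; swap)
open import Data.Product.Properties using (≡-dec)
open import Data.Sum.Base using (_⊎_; inj₁; inj₂; [_,_]′)
open import Data.Unit.Base using (⊤; tt)
open import Function.Base using (_∘_)
open import Function.Bundles using (_⇔_; mk⇔; Equivalence)
open import Function.Definitions using (Injective)
open import Function.Properties.Equivalence using (⇔-isEquivalence)
open import Relation.Binary.PropositionalEquality
open import Relation.Binary.Structures using (IsEquivalence)
open import Relation.Nullary using (¬_; Dec; does; yes; no; contradiction)
open import Relation.Nullary.Decidable using (_×-dec_; ¬?; dec-true; dec-false; decidable-stable)

open DecMembership _≟_ using (_∈?_)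

-- Non-adjacency of u and w does double duty: it keeps the contracted graph simple, and it prevents
-- a Hamiltonian triangle from shrinking to a two-vertex cycle. Checking it in G is enough, because
-- u lies outside B and acquires no edges in a gluing. Contraction changes no degree of a remaining
-- vertex, so X stays a solution and u still has degree two when a path or cycle is expanded again.
-- The outside vertices form at most |P| + 1 runs on a path, each of length at most two; this gives
-- 2 |P| + 2, and the exceptional triangle, where P is empty, raises the constant to 3. The negative
-- kernel needs vertices whose names occur in no admissible H, and two of them, since one vertex
-- alone is a Hamiltonian path. Outside vertices of G supply such names. On the computational side,
-- shared subtrees make running time useless as a bound on tree size, so every program carries a
-- polynomial bound on its output besides the one on its steps, and every fold needs a bound on its
-- intermediate values.

private variable
  A B C S : Set
  γ : C → Tree

-- Polynomial growth

infix 4 _≼_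

-- Powers of 2 + n, unlike those of n, absorb sums and constants.
_≼_ : (A → ℕ) → (A → ℕ) → Set
f ≼ s = ∃[ d ] ∀ a → f a ≤ (2 + s a) ^ d

≼-refl : {s : A → ℕ} → s ≼ s
≼-refl {s = s} = 1 , λ a → begin
  s a           ≤⟨ m≤n+m (s a) 2 ⟩
  2 + s a       ≡⟨ *-identityʳ (2 + s a) ⟨
  (2 + s a) ^ 1 ∎
  where open ≤-Reasoning

≤-≼ : {f g s : A → ℕ} → (∀ a → f a ≤ g a) → g ≼ s → f ≼ s
≤-≼ f≤g (d , g≤) = d , λ a → ≤-trans (f≤g a) (g≤ a)

+-≼ : {f g s : A → ℕ} → f ≼ s → g ≼ s → (λ a → f a + g a) ≼ s
+-≼ {f = f} {g} {s} (d , f≤) (e , g≤) = suc (d + e) , λ a → let x = 2 + s a in begin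
  f a + g a                 ≤⟨ +-mono-≤ (f≤ a) (g≤ a) ⟩
  x ^ d + x ^ e             ≤⟨ +-mono-≤ (^-monoʳ-≤ x (m≤m+n d e)) (^-monoʳ-≤ x (m≤n+m e d)) ⟩
  x ^ (d + e) + x ^ (d + e) ≤⟨ +-monoʳ-≤ (x ^ (d + e)) (m≤m+n (x ^ (d + e)) (s a * x ^ (d + e))) ⟩
  x * x ^ (d + e)           ∎
  where open ≤-Reasoning

*-≼ : {f g s : A → ℕ} → f ≼ s → g ≼ s → (λ a → f a * g a) ≼ s
*-≼ {s = s} (d , f≤) (e , g≤) = d + e , λ a →
  ≤-trans (*-mono-≤ (f≤ a) (g≤ a)) (≤-reflexive (sym (^-distribˡ-+-* (2 + s a) d e)))

const-≼ : (c : ℕ) {s : A → ℕ} → (λ _ → c) ≼ s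
const-≼ zero          = 0 , λ _ → z≤n
const-≼ (suc c) {s = s} = +-≼ {f = λ _ → 1} {g = λ _ → c} {s = s} (0 , λ _ → ≤-refl) (const-≼ c)

-- With `x = 2 + s a`, the inner base `2 + g a` is at most `4 * x ^ e`, and `x ≥ 2` turns the factor
-- four into two more powers of `x`.
≼-trans : {f g s : A → ℕ} → f ≼ g → g ≼ s → f ≼ s
≼-trans {f = f} {g} {s} (d , f≤) (e , g≤) = (2 + e) * d , λ a → let x = 2 + s a in begin
  f a                   ≤⟨ f≤ a ⟩
  (2 + g a) ^ d         ≤⟨ ^-monoˡ-≤ d (2+≤ x (s≤s (s≤s z≤n)) (g≤ a)) ⟩
  (x ^ (2 + e)) ^ d     ≡⟨ ^-*-assoc x (2 + e) d ⟩
  x ^ ((2 + e) * d)     ∎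
  where
  open ≤-Reasoning
  2+≤ : ∀ x {m} → 2 ≤ x → m ≤ x ^ e → 2 + m ≤ x ^ (2 + e)
  2+≤ x@(suc _) {m} 2≤x m≤ = begin
    2 + m                         ≤⟨ +-mono-≤ (*-monoʳ-≤ 2 (m^n>0 x e)) m≤ ⟩
    2 * x ^ e + x ^ e             ≤⟨ m≤m+n (2 * x ^ e + x ^ e) (x ^ e) ⟩
    2 * x ^ e + x ^ e + x ^ e     ≡⟨ lemma (x ^ e) ⟩
    2 * (2 * x ^ e)               ≤⟨ *-mono-≤ 2≤x (*-monoˡ-≤ (x ^ e) 2≤x) ⟩
    x * (x * x ^ e)               ∎
    where
    lemma : ∀ y → 2 * y + y + y ≡ 2 * (2 * y)
    lemma = solve-∀

≼-∘ : {f s : B → ℕ} (h : A → B) → f ≼ s → f ∘ h ≼ s ∘ h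
≼-∘ h (d , f≤) = d , f≤ ∘ h

^-≼ : {g s : A → ℕ} (d : ℕ) → g ≼ s → (λ a → (2 + g a) ^ d) ≼ s
^-≼ d = ≼-trans (d , λ _ → ≤-refl)

-- The additive constant covers `n = 0`; for positive `n`, `2 + n` is at most `3 * n`.
≼⇒polynomiallyBounded : (f : ℕ → ℕ) → f ≼ (λ n → n) → PolynomiallyBounded f
≼⇒polynomiallyBounded f (d , f≤) = 3 ^ d , d , λ n → ≤-trans (f≤ n) (bound n)
  where
  open ≤-Reasoning
  *-^ : ∀ m n d → (m * n) ^ d ≡ m ^ d * n ^ d
  *-^ m n zero    = refl
  *-^ m n (suc d) rewrite *-^ m n d = lemma m n (m ^ d) (n ^ d)
    where
    lemma : ∀ a b c e → a * b * (c * e) ≡ a * c * (b * e)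
    lemma = solve-∀
  bound : ∀ n → (2 + n) ^ d ≤ 3 ^ d * n ^ d + 3 ^ d
  bound zero    = ≤-trans (^-monoˡ-≤ d (s≤s (s≤s z≤n))) (m≤n+m (3 ^ d) _)
  bound (suc n) = begin
    (3 + n) ^ d                 ≤⟨ ^-monoˡ-≤ d (≤-trans (m≤m+n (3 + n) (2 * n)) (≤-reflexive (lemma n))) ⟩
    (3 * suc n) ^ d             ≡⟨ *-^ 3 (suc n) d ⟩
    3 ^ d * suc n ^ d           ≤⟨ m≤m+n _ (3 ^ d) ⟩
    3 ^ d * suc n ^ d + 3 ^ d   ∎
    where
    lemma : ∀ n → 3 + n + 2 * n ≡ 3 * suc n
    lemma = solve-∀

-- Polynomial-time functions between encoded types

infixr 5 _⊗_

_⊗_ : (A → Tree) → (B → Tree) → A × B → Tree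
(α ⊗ β) (a , b) = α a · β b

encodeBool : Bool → Tree
encodeBool false = nil
encodeBool true  = nil · nil

module _ (α : A → Tree) (β : B → Tree) where

  -- `size≼` does not follow from `steps≼`, because a short run can produce a huge tree by sharing.
  -- Composition needs it to bound the cost of the second program, and the running time of a
  -- kernelization charges for writing down the output.
  record Polytime (f : A → B) : Set where
    field
      program : Program
      steps   : A → ℕ
      run     : ∀ a → program ⊢ α a ⇓ β (f a) ∣ steps a
      steps≼  : steps ≼ size ∘ α
      size≼   : size ∘ β ∘ f ≼ size ∘ α

open Polytime

1≤size : ∀ t → 1 ≤ size t
1≤size nil     = s≤s z≤n
1≤size (_ · _) = s≤s z≤n

module _ {α : A → Tree} {β : B → Tree} where

  polytime-cong : {f g : A → B} → (∀ a → f a ≡ g a) → Polytime α β f → Polytime α β g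
  polytime-cong f≗g F = record
    { program = program F
    ; steps   = steps F
    ; run     = λ a → subst (λ b → program F ⊢ α a ⇓ β b ∣ steps F a) (f≗g a) (run F a)
    ; steps≼  = steps≼ F
    ; size≼   = ≤-≼ (λ a → ≤-reflexive (cong (size ∘ β) (sym (f≗g a)))) (size≼ F)
    }

  constant : (p : Program) (t : ℕ) (b : B) → (∀ {x} → p ⊢ x ⇓ β b ∣ t) → Polytime α β (λ _ → b)
  constant p t b run = record
    { program = p ; steps = λ _ → t ; run = λ _ → run ; steps≼ = const-≼ t ; size≼ = const-≼ (size (β b)) }

module _ {α : A → Tree} where

  identity : Polytime α α (λ a → a)
  identity = record
    { program = id ; steps = λ _ → 1 ; run = λ _ → id ; steps≼ = const-≼ 1 ; size≼ = ≼-refl }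

module _ {α : A → Tree} {β : B → Tree} {γ : C → Tree} {f : A → B} {g : B → C} where

  infixr 9 _∘ᵖ_

  _∘ᵖ_ : Polytime β γ g → Polytime α β f → Polytime α γ (λ a → g (f a))
  G ∘ᵖ F = record
    { program = program F ⨾ program G
    ; steps   = λ a → 1 + steps F a + steps G (f a)
    ; run     = λ a → seq (run F a) (run G (f a))
    ; steps≼  = +-≼ (+-≼ (const-≼ 1) (steps≼ F)) (≼-trans (≼-∘ f (steps≼ G)) (size≼ F))
    ; size≼   = ≼-trans (≼-∘ f (size≼ G)) (size≼ F)
    }

module _ {α : A → Tree} {β : B → Tree} {γ : C → Tree} {f : A → B} {g : A → C} where

  ⟨_,_⟩ : Polytime α β f → Polytime α γ g → Polytime α (β ⊗ γ) (λ a → f a , g a)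
  ⟨ F , G ⟩ = record
    { program = cons (program F) (program G)
    ; steps   = λ a → 1 + steps F a + steps G a
    ; run     = λ a → cons (run F a) (run G a)
    ; steps≼  = +-≼ (+-≼ (const-≼ 1) (steps≼ F)) (steps≼ G)
    ; size≼   = +-≼ (+-≼ (const-≼ 1) (size≼ F)) (size≼ G)
    }

module _ {α : A → Tree} {β : B → Tree} where

  first : Polytime (α ⊗ β) α proj₁
  first = record
    { program = hd ; steps = λ _ → 1 ; run = λ _ → hd-cons ; steps≼ = const-≼ 1
    ; size≼ = ≤-≼ (λ (a , b) → ≤-trans (m≤m+n _ (size (β b))) (n≤1+n _)) ≼-refl }

  second : Polytime (α ⊗ β) β proj₂
  second = record
    { program = tl ; steps = λ _ → 1 ; run = λ _ → tl-cons ; steps≼ = const-≼ 1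
    ; size≼ = ≤-≼ (λ (a , b) → ≤-trans (m≤n+m _ (size (α a))) (n≤1+n _)) ≼-refl }

module _ {α : A → Tree} {β : B → Tree} {c : A → Bool} {f g : A → B} where

  branch : Polytime α encodeBool c → Polytime α β f → Polytime α β g →
           Polytime α β (λ a → when c a then f a else g a)
  branch P F G = record
    { program = if program P then program F else program G
    ; steps   = λ a → 1 + steps P a + (when c a then steps F a else steps G a)
    ; run     = runs
    ; steps≼  = ≤-≼ (λ a → +-monoʳ-≤ (1 + steps P a) (if≤+ (c a) _ _))
                  (+-≼ (+-≼ (const-≼ 1) (steps≼ P)) (+-≼ (steps≼ F) (steps≼ G)))
    ; size≼   = ≤-≼ bound (+-≼ (size≼ F) (size≼ G))
    }
    where
    if≤+ : ∀ b m n → (when b then m else n) ≤ m + n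
    if≤+ false m n = m≤n+m n m
    if≤+ true  m n = m≤m+n m n
    runs : ∀ a → if program P then program F else program G ⊢ α a ⇓ β (when c a then f a else g a) ∣
                 1 + steps P a + (when c a then steps F a else steps G a)
    runs a with c a | run P a
    ... | true  | r = if-true r (run F a)
    ... | false | r = if-false r (run G a)
    bound : ∀ a → size (β (when c a then f a else g a)) ≤ size (β (f a)) + size (β (g a))
    bound a with c a
    ... | true  = m≤m+n _ _
    ... | false = m≤n+m _ _

module _ {α : A → Tree} where

  falseᵖ : Polytime α encodeBool (λ _ → false)
  falseᵖ = constant nil 1 false nil

  trueᵖ : Polytime α encodeBool (λ _ → true)
  trueᵖ = constant (cons nil nil) 3 true (cons nil nil)

  notᵖ : {f : A → Bool} → Polytime α encodeBool f → Polytime α encodeBool (λ a → not (f a))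
  notᵖ {f} F = polytime-cong (λ a → lemma (f a)) (branch F falseᵖ trueᵖ)
    where
    lemma : ∀ b → (when b then false else true) ≡ not b
    lemma false = refl
    lemma true  = refl

  andᵖ : {f g : A → Bool} → Polytime α encodeBool f → Polytime α encodeBool g →
         Polytime α encodeBool (λ a → f a ∧ g a)
  andᵖ {f} {g} F G = polytime-cong (λ a → lemma (f a) (g a)) (branch F G falseᵖ)
    where
    lemma : ∀ b c → (when b then c else false) ≡ b ∧ c
    lemma false _ = refl
    lemma true  _ = refl

  orᵖ : {f g : A → Bool} → Polytime α encodeBool f → Polytime α encodeBool g →
        Polytime α encodeBool (λ a → f a ∨ g a)
  orᵖ {f} {g} F G = polytime-cong (λ a → lemma (f a) (g a)) (branch F trueᵖ G)
    where
    lemma : ∀ b c → (when b then true else c) ≡ b ∨ c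
    lemma false _ = refl
    lemma true  _ = refl

module _ {α : A → Tree} {β : B → Tree} {f g : A → B} (_≟?_ : (x y : B) → Dec (x ≡ y)) where

  equalᵖ : Injective _≡_ _≡_ β → Polytime α β f → Polytime α β g →
           Polytime α encodeBool (λ a → does (f a ≟? g a))
  equalᵖ β-inj F G = record
    { program = equal (program F) (program G)
    ; steps   = λ a → 1 + steps F a + steps G a + size (β (f a)) + size (β (g a))
    ; run     = runs
    ; steps≼  = +-≼ (+-≼ (+-≼ (+-≼ (const-≼ 1) (steps≼ F)) (steps≼ G)) (size≼ F)) (size≼ G)
    ; size≼   = ≤-≼ (λ a → bound (does (f a ≟? g a))) (const-≼ 3)
    }
    where
    bound : ∀ b → size (encodeBool b) ≤ 3
    bound false = s≤s z≤n
    bound true  = ≤-refl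
    runs : ∀ a → equal (program F) (program G) ⊢ α a ⇓ encodeBool (does (f a ≟? g a)) ∣
                 1 + steps F a + steps G a + size (β (f a)) + size (β (g a))
    runs a with f a | g a | f a ≟? g a | run F a | run G a
    ... | _ | _ | yes refl | r | r′ = equal-yes r r′
    ... | _ | _ | no ≢     | r | r′ = equal-no r r′ (≢ ∘ β-inj)

-- Lists

caseList : List A → B → (A → List A → B) → B
caseList []       n k = n
caseList (x ∷ xs) n k = k x xs

module _ {α : A → Tree} where

  nilᵖ : {γ : C → Tree} → Polytime γ (encodeList α) (λ _ → [])
  nilᵖ = constant nil 1 [] nil

  consᵖ : {γ : C → Tree} {f : C → A} {g : C → List A} →
          Polytime γ α f → Polytime γ (encodeList α) g → Polytime γ (encodeList α) (λ c → f c ∷ g c)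
  consᵖ F G = record
    { program = program FG ; steps = steps FG ; run = run FG ; steps≼ = steps≼ FG ; size≼ = size≼ FG }
    where FG = ⟨ F , G ⟩

  -- Programs have no variables, so the continuation receives its context `c` as part of its input.
  -- A nonempty list is encoded exactly like the pair of its head and tail; pairing the input with a
  -- second evaluation of `xs` therefore yields the argument of `k` directly.
  caseListᵖ : {β : B → Tree} {γ : C → Tree} {xs : C → List A} {n : C → B} {k : C × (A × List A) → B} →
              Polytime γ (encodeList α) xs → Polytime γ β n →
              Polytime (γ ⊗ (α ⊗ encodeList α)) β k →
              Polytime γ β (λ c → caseList (xs c) (n c) (λ y ys → k (c , y , ys)))
  caseListᵖ {B = B} {C = C} {β} {γ} {xs} {n} {k} X N K = record
    { program = p
    ; steps   = λ c → 1 + steps X c + rest c (xs c)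
    ; run     = runs
    ; steps≼  = ≤-≼ (λ c → +-monoʳ-≤ (1 + steps X c) (rest≤ c))
        (+-≼ (+-≼ (const-≼ 1) (steps≼ X))
             (+-≼ (steps≼ N) (+-≼ (+-≼ (const-≼ 3) (steps≼ X)) (^-≼ (proj₁ (steps≼ K)) pair≼))))
    ; size≼   = ≤-≼ (λ c → size≤ c) (+-≼ (size≼ N) (^-≼ (proj₁ (size≼ K)) pair≼))
    }
    where
    p = if program X then cons id (program X) ⨾ program K else program N
    rest : C → List A → ℕ
    rest c []       = steps N c
    rest c (y ∷ ys) = 1 + (1 + 1 + steps X c) + steps K (c , y , ys)
    runs : ∀ c → p ⊢ γ c ⇓ β (caseList (xs c) (n c) (λ y ys → k (c , y , ys))) ∣ 1 + steps X c + rest c (xs c)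
    runs c with xs c | run X c
    ... | []     | r = if-false r (run N c)
    ... | y ∷ ys | r = if-true r (seq (cons id r) (run K (c , y , ys)))
    pair : C → ℕ
    pair c = size (γ c) + size (encodeList α (xs c)) + 1
    pair≼ : pair ≼ size ∘ γ
    pair≼ = +-≼ (+-≼ ≼-refl (size≼ X)) (const-≼ 1)
    pair≤ : ∀ c y ys d → (2 + size ((γ ⊗ (α ⊗ encodeList α)) (c , y , ys))) ^ d ≤
            (2 + (size (γ c) + size (encodeList α (y ∷ ys)) + 1)) ^ d
    pair≤ c y ys d = ^-monoˡ-≤ d (+-monoʳ-≤ 2 (≤-reflexive (+-comm 1 _)))
    rest≤ : ∀ c → rest c (xs c) ≤ steps N c + (3 + steps X c + (2 + pair c) ^ proj₁ (steps≼ K))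
    rest≤ c with xs c
    ... | []     = m≤m+n _ _
    ... | y ∷ ys = ≤-trans (+-monoʳ-≤ (3 + steps X c)
                     (≤-trans (proj₂ (steps≼ K) (c , y , ys)) (pair≤ c y ys (proj₁ (steps≼ K)))))
                     (m≤n+m _ (steps N c))
    size≤ : ∀ c → size (β (caseList (xs c) (n c) (λ y ys → k (c , y , ys)))) ≤
      size (β (n c)) + (2 + pair c) ^ proj₁ (size≼ K)
    size≤ c with xs c
    ... | []     = m≤m+n _ _
    ... | y ∷ ys = ≤-trans (≤-trans (proj₂ (size≼ K) (c , y , ys)) (pair≤ c y ys (proj₁ (size≼ K))))
                     (m≤n+m _ (size (β (n c))))

-- Loops with bounded states

-- A trace gives termination through its lap count and controls the cost of each lap through the
-- sizes of the states, so that the derivation of a loop and its step bound come out of one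
-- recursion.
data Trace (σ : S → Tree) (c : S → Bool) (g : S → S) (M : ℕ) : S → S → ℕ → Set where
  stop : ∀ {s} → c s ≡ false → size (σ s) ≤ M → Trace σ c g M s s 0
  step : ∀ {s s′ k} → c s ≡ true → size (σ s) ≤ M → Trace σ c g M (g s) s′ k → Trace σ c g M s s′ (suc k)

module _ {σ : S → Tree} {γ : C → Tree} {c : S → Bool} {g : S → S} {i h : C → S} where

  -- The bound M on the states is needed: as cons shares its arguments, n laps
  -- can produce a tree of size 2 ^ n.
  whileᵖ : Polytime σ encodeBool c → Polytime σ σ g → Polytime γ σ i →
           (M K : C → ℕ) → M ≼ size ∘ γ → K ≼ size ∘ γ →
           (∀ a → Trace σ c g (M a) (i a) (h a) (K a)) → Polytime γ σ h
  whileᵖ P G I M K M≼ K≼ trace = record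
    { program = program I ⨾ loop
    ; steps   = λ a → 1 + steps I a + proj₁ (runs (trace a))
    ; run     = λ a → seq (run I a) (proj₁ (proj₂ (runs (trace a))))
    ; steps≼  = ≤-≼ (λ a → +-monoʳ-≤ (1 + steps I a) (proj₂ (proj₂ (runs (trace a)))))
        (+-≼ (+-≼ (const-≼ 1) (steps≼ I))
             (*-≼ (+-≼ (const-≼ 1) K≼)
                  (+-≼ (+-≼ (const-≼ 1) (^-≼ (proj₁ (steps≼ P)) M≼)) (^-≼ (proj₁ (steps≼ G)) M≼))))
    ; size≼   = ≤-≼ (λ a → end≤ (trace a)) M≼
    }
    where
    loop = while program P loop program G
    module _ {m : ℕ} where
      lap : ℕ
      lap = 1 + (2 + m) ^ proj₁ (steps≼ P) + (2 + m) ^ proj₁ (steps≼ G)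
      test≤ : ∀ s → size (σ s) ≤ m → steps P s ≤ (2 + m) ^ proj₁ (steps≼ P)
      test≤ s s≤m = ≤-trans (proj₂ (steps≼ P) s) (^-monoˡ-≤ (proj₁ (steps≼ P)) (+-monoʳ-≤ 2 s≤m))
      body≤ : ∀ s → size (σ s) ≤ m → steps G s ≤ (2 + m) ^ proj₁ (steps≼ G)
      body≤ s s≤m = ≤-trans (proj₂ (steps≼ G) s) (^-monoˡ-≤ (proj₁ (steps≼ G)) (+-monoʳ-≤ 2 s≤m))
      runs : ∀ {s s′ k} → Trace σ c g m s s′ k →
             ∃[ t ] (loop ⊢ σ s ⇓ σ s′ ∣ t) × t ≤ suc k * lap
      runs (stop {s} ¬c s≤m) = 1 + steps P s , while-done test ,
        ≤-trans (s≤s (≤-trans (test≤ s s≤m) (m≤m+n _ _))) (m≤m+n lap 0)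
        where
        test : program P ⊢ σ s ⇓ nil ∣ steps P s
        test = subst (λ b → program P ⊢ σ s ⇓ encodeBool b ∣ steps P s) ¬c (run P s)
      runs (step {s} cs s≤m tr) with u , r , u≤ ← runs tr =
        1 + steps P s + steps G s + u , while-step test (run G s) r ,
        +-mono-≤ (+-mono-≤ (s≤s (test≤ s s≤m)) (body≤ s s≤m)) u≤
        where
        test : program P ⊢ σ s ⇓ nil · nil ∣ steps P s
        test = subst (λ b → program P ⊢ σ s ⇓ encodeBool b ∣ steps P s) cs (run P s)
      end≤ : ∀ {s s′ k} → Trace σ c g m s s′ k → size (σ s′) ≤ m
      end≤ (stop _ s≤m)  = s≤m
      end≤ (step _ _ tr) = end≤ tr

module _ (α : A → Tree) where

  length≤size : ∀ xs → length xs ≤ size (encodeList α xs)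
  length≤size []       = z≤n
  length≤size (x ∷ xs) = s≤s (≤-trans (length≤size xs) (m≤n+m _ _))

  -- Reversal only moves cells from one list to the other; the single unit lost is one of the two
  -- terminating `nil`s.
  size-ʳ++ : ∀ xs ys → size (encodeList α (xs ʳ++ ys)) + 1 ≡ size (encodeList α xs) + size (encodeList α ys)
  size-ʳ++ []       ys = +-comm _ 1
  size-ʳ++ (x ∷ xs) ys = trans (size-ʳ++ xs (x ∷ ys))
    (lemma (size (encodeList α xs)) (size (α x)) (size (encodeList α ys)))
    where
    lemma : ∀ a b c → a + suc (b + c) ≡ suc (b + a + c)
    lemma = solve-∀

  size-ʳ++≥ʳ : ∀ xs ys → size (encodeList α ys) ≤ size (encodeList α (xs ʳ++ ys))
  size-ʳ++≥ʳ xs ys = +-cancelʳ-≤ 1 _ _ (begin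
    size (encodeList α ys) + 1                      ≡⟨ +-comm _ 1 ⟩
    1 + size (encodeList α ys)                      ≤⟨ +-monoˡ-≤ _ (1≤size (encodeList α xs)) ⟩
    size (encodeList α xs) + size (encodeList α ys) ≡⟨ size-ʳ++ xs ys ⟨
    size (encodeList α (xs ʳ++ ys)) + 1             ∎)
    where open ≤-Reasoning

  size-ʳ++≥ˡ : ∀ xs ys → size (encodeList α xs) ≤ size (encodeList α (xs ʳ++ ys))
  size-ʳ++≥ˡ xs ys = +-cancelʳ-≤ 1 _ _ (begin
    size (encodeList α xs) + 1                      ≤⟨ +-monoʳ-≤ _ (1≤size (encodeList α ys)) ⟩
    size (encodeList α xs) + size (encodeList α ys) ≡⟨ size-ʳ++ xs ys ⟨
    size (encodeList α (xs ʳ++ ys)) + 1             ∎)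
    where open ≤-Reasoning

  size-reverse : ∀ xs → size (encodeList α (reverse xs)) ≡ size (encodeList α xs)
  size-reverse xs = +-cancelʳ-≡ 1 _ _ (size-ʳ++ xs [])

nonempty : List A → Bool
nonempty xs = caseList xs false (λ _ _ → true)

module _ {α : A → Tree} {γ : C → Tree} {xs : C → List A} where

  nonemptyᵖ : Polytime γ (encodeList α) xs → Polytime γ encodeBool (λ c → nonempty (xs c))
  nonemptyᵖ X = caseListᵖ X falseᵖ trueᵖ

module _ {α : A → Tree} where

  private
    σ = encodeList α ⊗ encodeList α
    body : List A × List A → List A × List A
    body (xs , ys) = caseList xs (xs , ys) (λ x xs → xs , x ∷ ys)
    bodyᵖ : Polytime σ σ body
    bodyᵖ = caseListᵖ first identity ⟨ second ∘ᵖ second , consᵖ (first ∘ᵖ second) (second ∘ᵖ first) ⟩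
    trace : ∀ xs ys → Trace σ (nonempty ∘ proj₁) body (2 + size (encodeList α (xs ʳ++ ys)))
                      (xs , ys) ([] , xs ʳ++ ys) (length xs)
    trace []       ys = stop refl ≤-refl
    trace (x ∷ xs) ys = step refl (≤-reflexive (trans (cong suc (sym (size-ʳ++ α (x ∷ xs) ys)))
                                                      (cong suc (+-comm _ 1))))
                                  (trace xs (x ∷ ys))

  reverseᵖ : {γ : C → Tree} {xs : C → List A} → Polytime γ (encodeList α) xs →
             Polytime γ (encodeList α) (λ c → reverse (xs c))
  reverseᵖ {γ = γ} {xs} X = second {α = encodeList α} ∘ᵖ
    whileᵖ (nonemptyᵖ first) bodyᵖ ⟨ X , nilᵖ ⟩ _ _
      (+-≼ (const-≼ 2) (≤-≼ (λ c → ≤-reflexive (size-reverse α (xs c))) (size≼ X)))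
      (≤-≼ (λ c → length≤size α (xs c)) (size≼ X))
      (λ c → trace (xs c) [])

module _ {α : A → Tree} {β : B → Tree} {γ : C → Tree}
         {xs : C → List A} {z : C → B} {f : C × (A × B) → B} where

  private
    σ = γ ⊗ (encodeList α ⊗ β)
    fold : C → List A → B
    fold c = foldr (λ x y → f (c , x , y)) (z c)
    body : C × (List A × B) → C × (List A × B)
    body (c , xs , y) = caseList xs (c , xs , y) (λ x xs → c , xs , f (c , x , y))

  -- A loop consumes a list from its head whereas `foldr` starts at the far end, so the list is
  -- reversed beforehand. Each intermediate accumulator is the fold of a suffix; a bound on folds of
  -- arbitrary lists therefore controls all states of the loop.
  foldrᵖ : Polytime γ (encodeList α) xs → Polytime γ β z → Polytime (γ ⊗ (α ⊗ β)) β f →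
           (λ (c , ys) → size (β (fold c ys))) ≼ size ∘ (γ ⊗ encodeList α) →
           Polytime γ β (λ c → foldr (λ x y → f (c , x , y)) (z c) (xs c))
  foldrᵖ X Z F fold≼ = second ∘ᵖ second {α = γ} ∘ᵖ polytime-cong (λ c → cong (λ ys → c , [] , fold c ys) (reverse-involutive (xs c)))
      (whileᵖ (nonemptyᵖ (first ∘ᵖ second)) bodyᵖ ⟨ identity , ⟨ reverseᵖ X , Z ⟩ ⟩ bound (λ c → length (reverse (xs c)))
         (+-≼ (+-≼ (+-≼ (const-≼ 2) ≼-refl) (size≼ X)) (^-≼ (proj₁ fold≼) (+-≼ (+-≼ (const-≼ 1) ≼-refl) (size≼ X))))
         (≤-≼ (λ c → ≤-trans (≤-reflexive (length-reverse (xs c))) (length≤size α (xs c))) (size≼ X))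
         (λ c → trace c (reverse (xs c)) [] (reverse-involutive (xs c))))
    where
    bodyᵖ : Polytime σ σ body
    bodyᵖ = caseListᵖ (first ∘ᵖ second) identity
      ⟨ first ∘ᵖ first , ⟨ second ∘ᵖ second ,
        F ∘ᵖ ⟨ first ∘ᵖ first , ⟨ first ∘ᵖ second , second ∘ᵖ second ∘ᵖ first ⟩ ⟩ ⟩ ⟩
    bound : C → ℕ
    bound c = 2 + size (γ c) + size (encodeList α (xs c))
            + (2 + (1 + size (γ c) + size (encodeList α (xs c)))) ^ proj₁ fold≼
    state≤ : ∀ c ys zs → ys ʳ++ zs ≡ xs c → size (σ (c , ys , fold c zs)) ≤ bound c
    state≤ c ys zs eq = begin
      1 + (size (γ c) + (1 + (size (encodeList α ys) + size (β (fold c zs)))))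
        ≡⟨ lemma (size (γ c)) (size (encodeList α ys)) _ ⟩
      2 + size (γ c) + size (encodeList α ys) + size (β (fold c zs))
        ≤⟨ +-mono-≤ (+-monoʳ-≤ (2 + size (γ c)) (list≤ (size-ʳ++≥ˡ α ys zs))) (proj₂ fold≼ (c , zs)) ⟩
      2 + size (γ c) + size (encodeList α (xs c)) + (2 + (1 + size (γ c) + size (encodeList α zs))) ^ proj₁ fold≼
        ≤⟨ +-monoʳ-≤ (2 + size (γ c) + size (encodeList α (xs c))) (^-monoˡ-≤ (proj₁ fold≼)
             (+-monoʳ-≤ (3 + size (γ c)) (list≤ (size-ʳ++≥ʳ α ys zs)))) ⟩
      bound c ∎
      where
      open ≤-Reasoning
      lemma : ∀ a b d → 1 + (a + (1 + (b + d))) ≡ 2 + a + b + d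
      lemma = solve-∀
      list≤ : ∀ {m} → m ≤ size (encodeList α (ys ʳ++ zs)) → m ≤ size (encodeList α (xs c))
      list≤ = subst (λ l → _ ≤ size (encodeList α l)) eq
    -- Invariant: `ys` is the unread part, in reverse order, and `zs` is the suffix already folded
    -- into the accumulator.
    trace : ∀ c ys zs → ys ʳ++ zs ≡ xs c →
            Trace σ (nonempty ∘ proj₁ ∘ proj₂) body (bound c)
              (c , ys , fold c zs) (c , [] , fold c (ys ʳ++ zs)) (length ys)
    trace c []       zs eq = stop refl (state≤ c [] zs eq)
    trace c (y ∷ ys) zs eq = step refl (state≤ c (y ∷ ys) zs eq) (trace c ys (y ∷ zs) eq)

module _ {α : A → Tree} {γ : C → Tree} {xs : C → List A} where

  dropᵖ : Polytime γ (encodeList α) xs → ∀ n → Polytime γ (encodeList α) (λ c → drop n (xs c))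
  dropᵖ X zero    = X
  dropᵖ X (suc n) = polytime-cong (λ c → lemma n (xs c)) (caseListᵖ (dropᵖ X n) nilᵖ (second ∘ᵖ second))
    where
    lemma : ∀ {A : Set} n (xs : List A) → caseList (drop n xs) [] (λ _ ys → ys) ≡ drop (suc n) xs
    lemma zero    []       = refl
    lemma zero    (x ∷ xs) = refl
    lemma (suc n) []       = refl
    lemma (suc n) (x ∷ xs) = lemma n xs

  appendᵖ : {ys : C → List A} → Polytime γ (encodeList α) xs → Polytime γ (encodeList α) ys →
            Polytime γ (encodeList α) (λ c → xs c ++ ys c)
  appendᵖ {ys} X Y = polytime-cong (λ c → foldr-∷ (xs c) (ys c))
    (foldrᵖ X Y (consᵖ (first ∘ᵖ second) (second ∘ᵖ second))
      (≤-≼ (λ (c , zs) → ≤-reflexive (cong (size ∘ encodeList α) (foldr-∷ zs (ys c))))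
      (≤-≼ (λ (c , zs) → size-++ zs (ys c))
      (+-≼ (≤-≼ (λ (c , zs) → ≤-trans (m≤n+m _ (size (γ c))) (n≤1+n _)) ≼-refl)
           (≼-trans (≼-∘ proj₁ (size≼ Y)) (size≼ (first {α = γ} {β = encodeList α})))))))
    where
    foldr-∷ : ∀ (xs ys : List A) → foldr _∷_ ys xs ≡ xs ++ ys
    foldr-∷ []       ys = refl
    foldr-∷ (x ∷ xs) ys = cong (x ∷_) (foldr-∷ xs ys)
    size-++ : ∀ xs ys → size (encodeList α (xs ++ ys)) ≤ size (encodeList α xs) + size (encodeList α ys)
    size-++ []       ys = n≤1+n _
    size-++ (x ∷ xs) ys = s≤s (≤-trans (+-monoʳ-≤ (size (α x)) (size-++ xs ys)) (≤-reflexive (sym (+-assoc (size (α x)) _ _))))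

  module _ {P : C → A → Set} {P? : ∀ c x → Dec (P c x)} where

    anyᵖ : Polytime (γ ⊗ α) encodeBool (λ (c , x) → does (P? c x)) → Polytime γ (encodeList α) xs →
           Polytime γ encodeBool (λ c → does (any? (P? c) (xs c)))
    anyᵖ Q X = polytime-cong (λ c → lemma c (xs c))
      (foldrᵖ X falseᵖ (orᵖ (Q ∘ᵖ ⟨ first , first ∘ᵖ second ⟩) (second ∘ᵖ second))
        (≤-≼ (λ _ → size-bool _) (const-≼ 3)))
      where
      size-bool : ∀ b → size (encodeBool b) ≤ 3
      size-bool false = s≤s z≤n
      size-bool true  = ≤-refl
      lemma : ∀ c xs → foldr (λ x b → does (P? c x) ∨ b) false xs ≡ does (any? (P? c) xs)
      lemma c []       = refl
      lemma c (x ∷ xs) = cong (does (P? c x) ∨_) (lemma c xs)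

    size-filter : ∀ c xs → size (encodeList α (filter (P? c) xs)) ≤ size (encodeList α xs)
    size-filter c []       = ≤-refl
    size-filter c (x ∷ xs) with does (P? c x)
    ... | false = ≤-trans (size-filter c xs) (≤-trans (m≤n+m _ (size (α x))) (n≤1+n _))
    ... | true  = s≤s (+-monoʳ-≤ (size (α x)) (size-filter c xs))

    filterᵖ : Polytime (γ ⊗ α) encodeBool (λ (c , x) → does (P? c x)) → Polytime γ (encodeList α) xs →
              Polytime γ (encodeList α) (λ c → filter (P? c) (xs c))
    filterᵖ Q X = polytime-cong (λ c → lemma c (xs c))
      (foldrᵖ X nilᵖ (branch (Q ∘ᵖ ⟨ first , first ∘ᵖ second ⟩) (consᵖ (first ∘ᵖ second) (second ∘ᵖ second)) (second ∘ᵖ second))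
        (≤-≼ (λ (c , xs) → ≤-reflexive (cong (size ∘ encodeList α) (lemma c xs)))
        (≤-≼ (λ (c , xs) → ≤-trans (size-filter c xs) (≤-trans (m≤n+m _ (size (γ c))) (n≤1+n _))) ≼-refl)))
      where
      lemma : ∀ c xs → foldr (λ x ys → when does (P? c x) then x ∷ ys else ys) [] xs ≡ filter (P? c) xs
      lemma c []       = refl
      lemma c (x ∷ xs) with does (P? c x)
      ... | false = lemma c xs
      ... | true  = cong (x ∷_) (lemma c xs)

-- Injectivity of the encodings

·-injective : ∀ {a b c d} → a · b ≡ c · d → a ≡ c × b ≡ d
·-injective refl = refl , refl

encodeᵇ-injective : Injective _≡_ _≡_ encodeᵇ
encodeᵇ-injective {ℕᵇ.zero} {ℕᵇ.zero} eq = refl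
encodeᵇ-injective {2[1+ x ]} {2[1+ y ]} eq = cong 2[1+_] (encodeᵇ-injective (proj₂ (·-injective eq)))
encodeᵇ-injective {1+[2 x ]} {1+[2 y ]} eq = cong 1+[2_] (encodeᵇ-injective (proj₂ (·-injective eq)))

encodeVertex-injective : Injective _≡_ _≡_ encodeVertex
encodeVertex-injective eq = fromℕ-injective (encodeᵇ-injective eq)

-- Unary arithmetic

private
  encode⊤ : ⊤ → Tree
  encode⊤ _ = nil

  unary≡ : ∀ n → unary n ≡ encodeList encode⊤ (replicate n tt)
  unary≡ zero    = refl
  unary≡ (suc n) = cong (nil ·_) (unary≡ n)

  size-unary : ∀ n → size (unary n) ≡ 1 + 2 * n
  size-unary zero    = refl
  size-unary (suc n) = trans (cong (2 +_) (size-unary n)) (lemma n)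
    where
    lemma : ∀ n → 2 + (1 + 2 * n) ≡ 1 + 2 * suc n
    lemma = solve-∀

  ≤size-unary : ∀ n → n ≤ size (unary n)
  ≤size-unary n = ≤-trans (m≤m+n n _) (≤-trans (n≤1+n _) (≤-reflexive (sym (size-unary n))))

-- A unary numeral is literally the encoding of a list of units, so the identity program converts
-- between them and arithmetic reduces to folding.
replicateᵖ : Polytime unary (encodeList encode⊤) (λ n → replicate n tt)
replicateᵖ = record
  { program = id ; steps = λ _ → 1
  ; run     = λ n → subst (λ t → id ⊢ unary n ⇓ t ∣ 1) (unary≡ n) id
  ; steps≼  = const-≼ 1
  ; size≼   = ≤-≼ (λ n → ≤-reflexive (cong size (sym (unary≡ n)))) ≼-refl
  }

zeroᵖ : Polytime γ unary (λ _ → 0)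
zeroᵖ = constant nil 1 0 nil

sucᵖ : {f : C → ℕ} → Polytime γ unary f → Polytime γ unary (λ c → suc (f c))
sucᵖ F = record
  { program = program F′ ; steps = steps F′ ; run = run F′ ; steps≼ = steps≼ F′ ; size≼ = size≼ F′ }
  where F′ = ⟨ nilᵖ {α = encode⊤} , F ⟩

addᵖ : {f g : C → ℕ} → Polytime γ unary f → Polytime γ unary g → Polytime γ unary (λ c → f c + g c)
addᵖ {γ = γ} {f} {g} F G = polytime-cong (λ c → trans (lemma (g c) (replicate (f c) tt)) (cong (_+ g c) (length-replicate (f c))))
  (foldrᵖ (replicateᵖ ∘ᵖ F) G (sucᵖ (second ∘ᵖ second))
    (≤-≼ (λ (c , xs) → bound c xs) (+-≼ (≤-≼ (λ (c , xs) → ≤-trans (m≤n+m _ (size (γ c))) (n≤1+n _)) ≼-refl)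
                                        (≼-trans (≼-∘ proj₁ (size≼ G)) (size≼ (first {α = γ} {β = encodeList encode⊤}))))))
  where
  lemma : ∀ n (xs : List ⊤) → foldr (λ _ → suc) n xs ≡ length xs + n
  lemma n []       = refl
  lemma n (_ ∷ xs) = cong suc (lemma n xs)
  bound : ∀ c xs → size (unary (foldr (λ _ → suc) (g c) xs)) ≤ size (encodeList encode⊤ xs) + size (unary (g c))
  bound c []       = n≤1+n _
  bound c (_ ∷ xs) = s≤s (s≤s (bound c xs))

squareᵖ : Polytime unary unary (λ n → n * n)
squareᵖ = polytime-cong (λ n → foldr-+ n n)
  (foldrᵖ replicateᵖ zeroᵖ (addᵖ first (second ∘ᵖ second))
    (≤-≼ (λ (n , xs) → ≤-trans (≤-reflexive (trans (cong (size ∘ unary) (foldr-* n xs)) (size-unary (length xs * n))))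
        (s≤s (*-monoʳ-≤ 2 (*-mono-≤ (≤-trans (length≤size encode⊤ xs) (≤-trans (m≤n+m _ (size (unary n))) (n≤1+n _)))
                                    (≤-trans (≤size-unary n) (≤-trans (m≤m+n _ (size (encodeList encode⊤ xs))) (n≤1+n _)))))))
     (+-≼ (const-≼ 1) (*-≼ (const-≼ 2) (*-≼ ≼-refl ≼-refl)))))
  where
  foldr-* : ∀ n (xs : List ⊤) → foldr (λ _ → n +_) 0 xs ≡ length xs * n
  foldr-* n []       = refl
  foldr-* n (_ ∷ xs) = cong (n +_) (foldr-* n xs)
  foldr-+ : ∀ m n → foldr (λ _ → n +_) 0 (replicate m tt) ≡ m * n
  foldr-+ zero    n = refl
  foldr-+ (suc m) n = cong (n +_) (foldr-+ m n)

-- The kernelization on lists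

-- Only meaningful if v is an end of the edge.
other : Vertex → Edge → Vertex
other v (a , b) = when does (v ≟ a) then b else a

-- The result is a list of at most one edge, which avoids a default edge for a vertex with fewer
-- than two incident edges.
bypass : Vertex → List Edge → List Edge
bypass v es = caseList es [] λ e es → caseList es [] λ e′ _ → (other v e , other v e′) ∷ []

shortcut : Vertex → List Edge → List Edge
shortcut v E = bypass v (filter (incident? v) E)

Reducible : List Vertex → List Edge → Vertex → Set
Reducible P E v = v ∉ P × Any (λ (u , w) → u ∉ P × w ∉ P × ¬ Any ((u , w) ≈ᵉ_) E) (shortcut v E)

reducible? : ∀ P E v → Dec (Reducible P E v)
reducible? P E v = ¬? (v ∈? P) ×-dec
  any? (λ (u , w) → ¬? (u ∈? P) ×-dec ¬? (w ∈? P) ×-dec ¬? (any? ((u , w) ≈ᵉ?_) E)) (shortcut v E)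

contractEdges : Vertex → List Edge → List Edge
contractEdges v E = shortcut v E ++ filter (λ e → ¬? (incident? v e)) E

contract : Vertex → List Vertex × List Edge → List Vertex × List Edge
contract v (V , E) = filter (λ x → ¬? (x ≟ v)) V , contractEdges v E

reduceOnce : List Vertex → List Vertex × List Edge → List Vertex × List Edge
reduceOnce P (V , E) = caseList (filter (reducible? P E) V) (V , E) λ v _ → contract v (V , E)

-- Folding over V only serves to iterate often enough.
reduce : List Vertex → List Vertex × List Edge → List Vertex × List Edge
reduce P (V , E) = foldr (λ _ → reduceOnce P) (V , E) V

outside : List Vertex → List Vertex → List Vertex
outside P V = filter (λ v → ¬? (v ∈? P)) V

-- All but 2 |P| + 2 of the vertices outside P.
surplus : List Vertex → List Vertex → List Vertex
surplus P V = foldr (λ _ → drop 2) (drop 2 (outside P V)) P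

Instance : Set
Instance = List Vertex × (List Vertex × List Edge) × List Vertex

-- The names `w₁` and `w₂` belong to vertices of the graph outside the boundary, so no graph that
-- can be glued to the input contains them. The replacement graph has no edges, hence all its
-- vertices must be in the solution. The two inner defaults are the same: a surplus of one vertex is
-- still tolerated.
finish : List Vertex → List Vertex → List Vertex × List Edge → (List Vertex × List Edge) × List Vertex
finish B X (V , E) =
  caseList (surplus (X ++ B) V) ((V , E) , X) λ w₁ ws →
  caseList ws ((V , E) , X) λ w₂ _ → (w₁ ∷ w₂ ∷ B , []) , w₁ ∷ w₂ ∷ B

kernel : Instance → Instance
kernel (B , VE , X) = B , finish B X (reduce (X ++ B) VE)

-- Polynomial-time programs for the kernelization

encodeVertices : List Vertex → Tree
encodeVertices = encodeList encodeVertex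

encodeEdges : List Edge → Tree
encodeEdges = encodeList encodeEdge

encodeEdge-injective : Injective _≡_ _≡_ encodeEdge
encodeEdge-injective eq with p , q ← ·-injective eq =
  cong₂ _,_ (encodeVertex-injective p) (encodeVertex-injective q)

memberᵖ : {v : C → Vertex} {xs : C → List Vertex} → Polytime γ encodeVertex v → Polytime γ encodeVertices xs →
          Polytime γ encodeBool (λ c → does (v c ∈? xs c))
memberᵖ {v = v} V X = anyᵖ {P? = λ c x → v c ≟ x} (equalᵖ _≟_ encodeVertex-injective (V ∘ᵖ first) second) X

sourceᵖ : {e : C → Edge} → Polytime γ encodeEdge e → Polytime γ encodeVertex (λ c → proj₁ (e c))
sourceᵖ E = first {α = encodeVertex} {β = encodeVertex} ∘ᵖ E

targetᵖ : {e : C → Edge} → Polytime γ encodeEdge e → Polytime γ encodeVertex (λ c → proj₂ (e c))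
targetᵖ E = second {α = encodeVertex} {β = encodeVertex} ∘ᵖ E

incidentᵖ : {v : C → Vertex} {e : C → Edge} → Polytime γ encodeVertex v → Polytime γ encodeEdge e →
            Polytime γ encodeBool (λ c → does (incident? (v c) (e c)))
incidentᵖ V E = orᵖ (equalᵖ _≟_ encodeVertex-injective V (sourceᵖ E)) (equalᵖ _≟_ encodeVertex-injective V (targetᵖ E))

otherᵖ : {v : C → Vertex} {e : C → Edge} → Polytime γ encodeVertex v → Polytime γ encodeEdge e →
         Polytime γ encodeVertex (λ c → other (v c) (e c))
otherᵖ V E = branch (equalᵖ _≟_ encodeVertex-injective V (sourceᵖ E)) (targetᵖ E) (sourceᵖ E)

sameEdgeᵖ : {e f : C → Edge} → Polytime γ encodeEdge e → Polytime γ encodeEdge f →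
            Polytime γ encodeBool (λ c → does (e c ≈ᵉ? f c))
sameEdgeᵖ {f = f} E F = orᵖ (equalᵖ (≡-dec _≟_ _≟_) encodeEdge-injective E F)
  (equalᵖ {g = λ c → swap (f c)} (≡-dec _≟_ _≟_) encodeEdge-injective E ⟨ targetᵖ F , sourceᵖ F ⟩)

shortcutᵖ : {v : C → Vertex} {E : C → List Edge} → Polytime γ encodeVertex v → Polytime γ encodeEdges E →
            Polytime γ encodeEdges (λ c → shortcut (v c) (E c))
shortcutᵖ {v = v} V E =
  caseListᵖ (filterᵖ {P? = λ c → incident? (v c)} (incidentᵖ (V ∘ᵖ first) second) E) nilᵖ
  (caseListᵖ (second ∘ᵖ second) nilᵖ
  (consᵖ ⟨ otherᵖ (V ∘ᵖ first ∘ᵖ first) (first ∘ᵖ second ∘ᵖ first) , otherᵖ (V ∘ᵖ first ∘ᵖ first) (first ∘ᵖ second) ⟩ nilᵖ))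

reducibleᵖ : {P : C → List Vertex} {E : C → List Edge} {v : C → Vertex} →
             Polytime γ encodeVertices P → Polytime γ encodeEdges E → Polytime γ encodeVertex v →
             Polytime γ encodeBool (λ c → does (reducible? (P c) (E c) (v c)))
reducibleᵖ {P = P} {E} Pᵖ Eᵖ V = andᵖ (notᵖ (memberᵖ V Pᵖ))
  (anyᵖ {P? = λ c (u , w) → ¬? (u ∈? P c) ×-dec ¬? (w ∈? P c) ×-dec ¬? (any? ((u , w) ≈ᵉ?_) (E c))}
    (andᵖ (notᵖ (memberᵖ (sourceᵖ second) (Pᵖ ∘ᵖ first)))
    (andᵖ (notᵖ (memberᵖ (targetᵖ second) (Pᵖ ∘ᵖ first)))
          (notᵖ (anyᵖ {P? = λ (c , uw) → uw ≈ᵉ?_} (sameEdgeᵖ (second ∘ᵖ first) second) (Eᵖ ∘ᵖ first)))))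
    (shortcutᵖ V Eᵖ))

contractᵖ : {v : C → Vertex} {V : C → List Vertex} {E : C → List Edge} →
            Polytime γ encodeVertex v → Polytime γ encodeVertices V → Polytime γ encodeEdges E →
            Polytime γ (encodeVertices ⊗ encodeEdges) (λ c → contract (v c) (V c , E c))
contractᵖ {v = v} vᵖ Vᵖ Eᵖ =
  ⟨ filterᵖ {P? = λ c x → ¬? (x ≟ v c)} (notᵖ (equalᵖ _≟_ encodeVertex-injective second (vᵖ ∘ᵖ first))) Vᵖ
  , appendᵖ (shortcutᵖ vᵖ Eᵖ) (filterᵖ {P? = λ c e → ¬? (incident? (v c) e)} (notᵖ (incidentᵖ (vᵖ ∘ᵖ first) second)) Eᵖ) ⟩

reduceOnceᵖ : {P : C → List Vertex} {V : C → List Vertex} {E : C → List Edge} →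
              Polytime γ encodeVertices P → Polytime γ encodeVertices V → Polytime γ encodeEdges E →
              Polytime γ (encodeVertices ⊗ encodeEdges) (λ c → reduceOnce (P c) (V c , E c))
reduceOnceᵖ {P = P} {V} {E} Pᵖ Vᵖ Eᵖ =
  caseListᵖ (filterᵖ {P? = λ c → reducible? (P c) (E c)} (reducibleᵖ (Pᵖ ∘ᵖ first) (Eᵖ ∘ᵖ first) second) Vᵖ)
    ⟨ Vᵖ , Eᵖ ⟩
    (contractᵖ (first ∘ᵖ second) (Vᵖ ∘ᵖ first) (Eᵖ ∘ᵖ first))

size-partition : ∀ {A : Set} {α : A → Tree} {P : A → Set} (P? : ∀ x → Dec (P x)) xs →
  size (encodeList α (filter P? xs)) + size (encodeList α (filter (¬? ∘ P?) xs)) ≡ 1 + size (encodeList α xs)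
size-partition P? [] = refl
size-partition {α = α} P? (x ∷ xs) with does (P? x)
... | true  = trans (cong suc (+-assoc (size (α x)) _ _))
  (trans (cong (λ n → suc (size (α x) + n)) (size-partition P? xs)) (cong suc (+-suc _ _)))
... | false = trans (+-suc _ _) (cong suc (trans (lemma (size (encodeList α (filter P? xs))) (size (α x)) _)
  (trans (cong (size (α x) +_) (size-partition P? xs)) (+-suc _ _))))
  where
  lemma : ∀ a b c → a + (b + c) ≡ b + (a + c)
  lemma = solve-∀

-- The new edge is written with one end of each of two removed edges, so it is no longer than those
-- two together. As a contraction never lengthens the encoding, the size of the input bounds every
-- intermediate graph in `reduceᵖ`.
size-contractEdges : ∀ v E → size (encodeEdges (contractEdges v E)) ≤ size (encodeEdges E)
size-contractEdges v E = ≤-pred (≤-trans (bound (filter (incident? v) E) _) (≤-reflexive (size-partition (incident? v) E)))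
  where
  size-other : ∀ e → size (encodeVertex (other v e)) ≤ size (encodeEdge e)
  size-other (a , b) with does (v ≟ a)
  ... | true  = ≤-trans (m≤n+m _ (size (encodeVertex a))) (n≤1+n _)
  ... | false = ≤-trans (m≤m+n _ _) (n≤1+n _)
  bound : ∀ es fs → suc (size (encodeEdges (bypass v es ++ fs))) ≤ size (encodeEdges es) + size (encodeEdges fs)
  bound []       fs = ≤-refl
  bound (e ∷ []) fs = s≤s (≤-trans (m≤n+m _ (size (encodeEdge e))) (≤-trans (n≤1+n _) (≤-reflexive (lemma (size (encodeEdge e)) _))))
    where
    lemma : ∀ a b → suc (a + b) ≡ a + 1 + b
    lemma = solve-∀
  bound (e ∷ e′ ∷ es) fs = begin
    2 + (suc (size (encodeVertex (other v e)) + size (encodeVertex (other v e′))) + size (encodeEdges fs))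
      ≤⟨ s≤s (s≤s (+-monoˡ-≤ (size (encodeEdges fs)) (s≤s (+-mono-≤ (size-other e) (size-other e′))))) ⟩
    2 + (suc (size (encodeEdge e) + size (encodeEdge e′)) + size (encodeEdges fs))
      ≡⟨ lemma (size (encodeEdge e)) (size (encodeEdge e′)) (size (encodeEdges fs)) ⟩
    suc (size (encodeEdge e) + suc (size (encodeEdge e′) + 1)) + size (encodeEdges fs)
      ≤⟨ +-monoˡ-≤ (size (encodeEdges fs)) (s≤s (+-monoʳ-≤ (size (encodeEdge e)) (s≤s
           (+-monoʳ-≤ (size (encodeEdge e′)) (1≤size (encodeEdges es)))))) ⟩
    suc (size (encodeEdge e) + suc (size (encodeEdge e′) + size (encodeEdges es))) + size (encodeEdges fs) ∎
    where
    open ≤-Reasoning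
    lemma : ∀ a b c → 2 + (suc (a + b) + c) ≡ suc (a + suc (b + 1)) + c
    lemma = solve-∀

encodeVE : List Vertex × List Edge → Tree
encodeVE = encodeVertices ⊗ encodeEdges

size-reduceOnce : ∀ P G → size (encodeVE (reduceOnce P G)) ≤ size (encodeVE G)
size-reduceOnce P (V , E) with filter (reducible? P E) V
... | []    = ≤-refl
... | v ∷ _ = s≤s (+-mono-≤
  (size-filter {γ = encodeVertices} {xs = λ xs → xs} {P? = λ _ x → ¬? (x ≟ v)} [] V) (size-contractEdges v E))

reduceᵖ : {P V : C → List Vertex} {E : C → List Edge} →
          Polytime γ encodeVertices P → Polytime γ encodeVertices V → Polytime γ encodeEdges E →
          Polytime γ encodeVE (λ c → reduce (P c) (V c , E c))
reduceᵖ {γ = γ} {P = P} {V} {E} Pᵖ Vᵖ Eᵖ =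
  foldrᵖ Vᵖ ⟨ Vᵖ , Eᵖ ⟩ (reduceOnceᵖ (Pᵖ ∘ᵖ first) (first ∘ᵖ second ∘ᵖ second) (second ∘ᵖ second ∘ᵖ second))
    (≤-≼ (λ (c , xs) → bound c xs) (≼-trans (≼-∘ proj₁ (size≼ ⟨ Vᵖ , Eᵖ ⟩)) (size≼ (first {α = γ} {β = encodeVertices}))))
  where
  bound : ∀ c xs → size (encodeVE (foldr (λ _ → reduceOnce (P c)) (V c , E c) xs)) ≤ size (encodeVE (V c , E c))
  bound c []       = ≤-refl
  bound c (x ∷ xs) = ≤-trans (size-reduceOnce (P c) (foldr (λ _ → reduceOnce (P c)) (V c , E c) xs)) (bound c xs)

size-drop : ∀ {A : Set} (α : A → Tree) n xs → size (encodeList α (drop n xs)) ≤ size (encodeList α xs)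
size-drop α zero    xs       = ≤-refl
size-drop α (suc n) []       = ≤-refl
size-drop α (suc n) (x ∷ xs) = ≤-trans (size-drop α n xs) (≤-trans (m≤n+m _ (size (α x))) (n≤1+n _))

surplusᵖ : {P V : C → List Vertex} → Polytime γ encodeVertices P → Polytime γ encodeVertices V →
           Polytime γ encodeVertices (λ c → surplus (P c) (V c))
surplusᵖ {γ = γ} {P = P} {V} Pᵖ Vᵖ =
  foldrᵖ Pᵖ N (dropᵖ (second ∘ᵖ second) 2)
    (≤-≼ (λ (c , xs) → bound _ xs) (≼-trans (≼-∘ proj₁ (size≼ N)) (size≼ (first {α = γ} {β = encodeVertices}))))
  where
  N : Polytime _ encodeVertices (λ c → drop 2 (outside (P c) (V c)))
  N = dropᵖ (filterᵖ {P? = λ c v → ¬? (v ∈? P c)} (notᵖ (memberᵖ second (Pᵖ ∘ᵖ first))) Vᵖ) 2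
  bound : ∀ z (xs : List Vertex) → size (encodeVertices (foldr (λ _ → drop 2) z xs)) ≤ size (encodeVertices z)
  bound z []       = ≤-refl
  bound z (x ∷ xs) = ≤-trans (size-drop encodeVertex 2 (foldr (λ _ → drop 2) z xs)) (bound z xs)

-- Definitionally the encoding `encodeInstance` for `#v,deg≢2` once sets and graphs are stripped of
-- their proofs, so a run on lists is already a run on instances.
encodeTriple : Instance → Tree
encodeTriple = encodeVertices ⊗ encodeVE ⊗ encodeVertices

finishᵖ : {B X V : C → List Vertex} {E : C → List Edge} →
          Polytime γ encodeVertices B → Polytime γ encodeVertices X → Polytime γ encodeVertices V → Polytime γ encodeEdges E →
          Polytime γ (encodeVE ⊗ encodeVertices) (λ c → finish (B c) (X c) (V c , E c))
finishᵖ B X V E =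
  caseListᵖ (surplusᵖ (appendᵖ X B) V) ⟨ ⟨ V , E ⟩ , X ⟩
  (caseListᵖ (second ∘ᵖ second) (⟨ ⟨ V , E ⟩ , X ⟩ ∘ᵖ first)
  (⟨ ⟨ witnesses , nilᵖ ⟩ , witnesses ⟩))
  where
  witnesses = consᵖ (first ∘ᵖ second ∘ᵖ first) (consᵖ (first ∘ᵖ second) (B ∘ᵖ first ∘ᵖ first))

abstract
  kernelᵖ : Polytime encodeTriple encodeTriple kernel
  kernelᵖ = ⟨ first , finishᵖ first (second ∘ᵖ second) (first ∘ᵖ first ∘ᵖ second) (second ∘ᵖ first ∘ᵖ second) ∘ᵖ
    ⟨ first , ⟨ reduceᵖ (appendᵖ (second ∘ᵖ second) first) (first ∘ᵖ first ∘ᵖ second) (second ∘ᵖ first ∘ᵖ second)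
              , second ∘ᵖ second ⟩ ⟩ ⟩

-- Hamiltonian paths and cycles

module _ {A : Set} where

  private variable
    R R′ : A → A → Set
    x y : A
    xs ys : List A

  linked-++⁻ : ∀ xs → Linked R (xs ++ y ∷ ys) → Linked R (xs ∷ʳ y) × Linked R (y ∷ ys)
  linked-++⁻ []           l       = [-] , l
  linked-++⁻ (x ∷ [])     (r ∷ l) = r ∷ [-] , l
  linked-++⁻ (x ∷ z ∷ xs) (r ∷ l) with l₁ , l₂ ← linked-++⁻ (z ∷ xs) l = r ∷ l₁ , l₂

  linked-++⁺ : ∀ xs → Linked R (xs ∷ʳ y) → Linked R (y ∷ ys) → Linked R (xs ++ y ∷ ys)
  linked-++⁺ []           _       l = l
  linked-++⁺ (x ∷ [])     (r ∷ _) l = r ∷ l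
  linked-++⁺ (x ∷ z ∷ xs) (r ∷ k) l = r ∷ linked-++⁺ (z ∷ xs) k l

  linked-∷ʳ⁻ : ∀ xs → Linked R (xs ∷ʳ x ∷ʳ y) → Linked R (xs ∷ʳ x) × R x y
  linked-∷ʳ⁻ {x = x} {y} xs l
    with l₁ , r ∷ [-] ← linked-++⁻ xs (subst (Linked _) (++-assoc xs (x ∷ []) (y ∷ [])) l) = l₁ , r

  linked-∷ʳ⁺ : ∀ xs → Linked R (xs ∷ʳ x) → R x y → Linked R (xs ∷ʳ x ∷ʳ y)
  linked-∷ʳ⁺ {x = x} {y} xs l r =
    subst (Linked _) (sym (++-assoc xs (x ∷ []) (y ∷ []))) (linked-++⁺ xs l (r ∷ [-]))

  linked-init : ∀ xs → Linked R (xs ∷ʳ x) → Linked R xs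
  linked-init []           _       = []
  linked-init (x ∷ [])     _       = [-]
  linked-init (x ∷ z ∷ xs) (r ∷ l) = r ∷ linked-init (z ∷ xs) l

  linked-map∈ : (∀ {x y} → x ∈ xs → y ∈ xs → R x y → R′ x y) → Linked R xs → Linked R′ xs
  linked-map∈ f []      = []
  linked-map∈ f [-]     = [-]
  linked-map∈ f (r ∷ l) = f (here refl) (there (here refl)) r ∷ linked-map∈ (λ p q → f (there p) (there q)) l

  unique-resp-↭ : xs ↭ ys → Unique xs → Unique ys
  unique-resp-↭ p = Unique-resp-↭ (setoid _) (↭⇒↭ₛ p)

  unique-mid : ∀ xs → Unique (xs ++ y ∷ ys) → y ∉ xs × y ∉ ys
  unique-mid []       (y∉ ∷ _) = (λ ()) , λ y∈ → All.lookup y∉ y∈ refl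
  unique-mid (x ∷ xs) (x∉ ∷ u) with ∉xs , ∉ys ← unique-mid xs u =
    (λ { (here refl) → All.lookup x∉ (∈-++⁺ʳ xs (here refl)) refl ; (there p) → ∉xs p }) , ∉ys

  unique-head : Unique (x ∷ xs) → x ∉ xs
  unique-head U = proj₂ (unique-mid [] U)

  unique-ends : ∀ xs → Unique (x ∷ xs ∷ʳ y) → x ≢ y
  unique-ends xs U refl = unique-head U (∈-++⁺ʳ xs (here refl))

  unique-pair : ∀ xs {zs} → Unique ((xs ∷ʳ x) ++ zs) → x ∉ zs
  unique-pair {x = x} xs {zs} U = proj₂ (unique-mid xs (subst Unique (++-assoc xs (x ∷ []) zs) U))

  Path : (A → A → Set) → List A → Set
  Path R W = ∃[ p ] p ↭ W × Linked R p

  Cycle : (A → A → Set) → List A → Set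
  Cycle R W = ∃[ v ] ∃[ vs ] ((v ∷ vs) ↭ W) × Linked R ((v ∷ vs) ∷ʳ v) × 3 ≤ length (v ∷ vs)

  -- Cutting the cycle at `x` swaps two arcs. Local changes to a cycle can thus assume that the
  -- vertex concerned comes at the head.
  rotate : {W : List A} → Cycle R W → x ∈ W →
           ∃[ vs ] ((x ∷ vs) ↭ W) × Linked R ((x ∷ vs) ∷ʳ x) × 3 ≤ length (x ∷ vs)
  rotate {x = x} (v , vs , p , l , n) x∈ with ∈-∃++ (∈-resp-↭ (↭-sym p) x∈)
  ... | []     , bs , refl = bs , p , l , n
  ... | .v ∷ as , bs , refl
    with l₁ , l₂ ← linked-++⁻ (v ∷ as) (subst (Linked _) (cong (v ∷_) (++-assoc as (x ∷ bs) (v ∷ []))) l) =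
    bs ++ v ∷ as , ↭-trans rot p ,
    subst (Linked _) (cong (x ∷_) (sym (++-assoc bs (v ∷ as) (x ∷ [])))) (linked-++⁺ (x ∷ bs) l₂ l₁) ,
    ≤-trans n (≤-reflexive (↭-length (↭-sym rot)))
    where
    rot : x ∷ bs ++ v ∷ as ↭ v ∷ as ++ x ∷ bs
    rot = ++-comm (x ∷ bs) (v ∷ as)

-- R′ arises from R by contracting the edge between v, whose neighbours are
-- u and w, and u, whose neighbours are v and t.
record Contraction (R R′ : A → A → Set) (v u w t : A) : Set where
  field
    R-sym    : ∀ {a b} → R a b → R b a
    R′-sym   : ∀ {a b} → R′ a b → R′ b a
    R⇒R′     : ∀ {a b} → a ≢ v → b ≢ v → R a b → R′ a b
    R′⇒R     : ∀ {a b} → R′ a b → R a b ⊎ (a ≡ u × b ≡ w) ⊎ (a ≡ w × b ≡ u)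
    v-u      : R v u
    v-w      : R v w
    v-only   : ∀ {a} → R v a → a ≡ u ⊎ a ≡ w
    u′-w     : R′ u w
    u′-only  : ∀ {a} → R′ u a → a ≡ w ⊎ a ≡ t
    u≢w      : u ≢ w
    ¬u-w     : ¬ R u w

module _ {R R′ : Vertex → Vertex → Set} {v u w t : Vertex} (contraction : Contraction R R′ v u w t)
         {W W′ : List Vertex} (W↭ : W ↭ v ∷ W′) (unique : Unique W) (u∈ : u ∈ W′) where

  open Contraction contraction

  private
    unique′ : Unique W′
    unique′ with _ ∷ U ← unique-resp-↭ W↭ unique = U

    avoid-v : ∀ {p} → v ∉ p → Linked R p → Linked R′ p
    avoid-v v∉ = linked-map∈ λ a∈ b∈ → R⇒R′ (λ { refl → v∉ a∈ }) (λ { refl → v∉ b∈ })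

    avoid-u : ∀ {p} → u ∉ p → Linked R′ p → Linked R p
    avoid-u u∉ = linked-map∈ λ a∈ b∈ r → [ (λ r → r) ,
      [ (λ { (refl , _) → contradiction a∈ u∉ }) , (λ { (_ , refl) → contradiction b∈ u∉ }) ]′ ]′ (R′⇒R r)

    u-≢w : ∀ {a} → a ≢ w → R′ u a → R u a
    u-≢w ≢ r = [ (λ r → r) ,
      [ (λ { (_ , refl) → contradiction refl ≢ }) , (λ { (refl , _) → contradiction refl u≢w }) ]′ ]′ (R′⇒R r)

    u-two : ∀ {a b} → a ≢ w → b ≢ w → R′ u a → R′ u b → a ≡ b
    u-two a≢ b≢ r s with u′-only r | u′-only s
    ... | inj₁ refl | _         = contradiction refl a≢
    ... | _         | inj₁ refl = contradiction refl b≢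
    ... | inj₂ refl | inj₂ refl = refl

    v-two : ∀ {a b} → a ≢ b → R v a → R v b → (a ≡ u × b ≡ w) ⊎ (a ≡ w × b ≡ u)
    v-two a≢b r s with v-only r | v-only s
    ... | inj₁ refl | inj₁ refl = contradiction refl a≢b
    ... | inj₁ refl | inj₂ refl = inj₁ (refl , refl)
    ... | inj₂ refl | inj₁ refl = inj₂ (refl , refl)
    ... | inj₂ refl | inj₂ refl = contradiction refl a≢b

    v-skip : ∀ {a b} → a ≢ b → R v a → R v b → R′ a b
    v-skip a≢b r s with v-two a≢b r s
    ... | inj₁ (refl , refl) = u′-w
    ... | inj₂ (refl , refl) = R′-sym u′-w

    -- The only edge that may be missing in `R` joins `u` to `w`, and `w` lies elsewhere.
    u-leave : ∀ {bs} → w ∉ bs → u ∉ bs → Linked R′ (u ∷ bs) → Linked R (u ∷ bs)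
    u-leave w∉ u∉ [-]     = [-]
    u-leave w∉ u∉ (r ∷ l) = u-≢w (λ { refl → w∉ (here refl) }) r ∷ avoid-u u∉ l

  -- An end vertex `v` is simply dropped. An inner `v` has two distinct neighbours on the path,
  -- which must be `u` and `w` in some order, and the new edge closes the gap.
  path-contract : Path R W → Path R′ W′
  path-contract (p , p↭ , l) with ∈-∃++ (∈-resp-↭ (↭-sym (↭-trans p↭ W↭)) (here refl))
  ... | as , bs , refl = as ++ bs , drop-mid as [] (↭-trans p↭ W↭) , linked (initLast as) bs U l
    where
    U : Unique (as ++ v ∷ bs)
    U = unique-resp-↭ (↭-sym p↭) unique
    linked : ∀ {as} → InitLast as → ∀ bs → Unique (as ++ v ∷ bs) → Linked R (as ++ v ∷ bs) → Linked R′ (as ++ bs)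
    linked []          bs       U l with _ , v∉ ← unique-mid [] U | l
    ... | [-]   = []
    ... | _ ∷ l = avoid-v v∉ l
    linked (as ∷ʳ′ a)  []       U l with v∉ , _ ← unique-mid (as ∷ʳ a) U =
      subst (Linked R′) (sym (++-assoc as (a ∷ []) []))
        (linked-++⁺ as (avoid-v v∉ (linked-init (as ∷ʳ a) l)) [-])
    linked (as ∷ʳ′ a)  (b ∷ bs) U l
      with v∉as , v∉bs ← unique-mid (as ∷ʳ a) U
      with l₁ , r ∷ l₂ ← linked-++⁻ (as ∷ʳ a) l
      with l₃ , s ← linked-∷ʳ⁻ as l₁ =
      subst (Linked R′) (sym (++-assoc as (a ∷ []) (b ∷ bs)))
        (linked-++⁺ as (avoid-v v∉as l₃) (v-skip a≢b (R-sym s) r ∷ avoid-v v∉bs l₂))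
      where
      a≢b : a ≢ b
      a≢b refl = unique-pair as U (there (here refl))

  -- The path is cut at `u`, since every edge of `R′` not incident with `u` is an edge of `R`. If
  -- `w` is next to `u`, then `v` goes between them; otherwise `v` becomes the new end beside `u`.
  path-expand : Path R′ W′ → Path R W
  path-expand (p , p↭ , l) with ∈-∃++ (∈-resp-↭ (↭-sym p↭) u∈)
  ... | as , bs , refl = insert (initLast as) bs U (↭-trans (prep v p↭) (↭-sym W↭)) l
    where
    U : Unique (as ++ u ∷ bs)
    U = unique-resp-↭ (↭-sym p↭) unique′
    before : ∀ as bs → v ∷ as ++ u ∷ bs ↭ W → as ++ v ∷ u ∷ bs ↭ W
    before as bs = ↭-trans (shift v as (u ∷ bs))
    after : ∀ as bs → v ∷ as ++ u ∷ bs ↭ W → as ++ u ∷ v ∷ bs ↭ W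
    after as bs p = ↭-trans (↭-reflexive (sym (++-assoc as (u ∷ []) (v ∷ bs))))
      (↭-trans (shift v (as ∷ʳ u) bs) (↭-trans (prep v (↭-reflexive (++-assoc as (u ∷ []) bs))) p))
    insert : ∀ {as} → InitLast as → ∀ bs → Unique (as ++ u ∷ bs) → v ∷ as ++ u ∷ bs ↭ W →
             Linked R′ (as ++ u ∷ bs) → Path R W
    insert [] [] U p l = _ , before [] [] p , v-u ∷ [-]
    insert [] (b ∷ bs) U p (r ∷ l) with b ≟ w | unique-mid [] U
    ... | yes refl | _ , u∉ = _ , after [] (b ∷ bs) p , R-sym v-u ∷ v-w ∷ avoid-u u∉ l
    ... | no b≢w   | _ , u∉ = _ , before [] (b ∷ bs) p , v-u ∷ u-≢w b≢w r ∷ avoid-u u∉ l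
    insert (as ∷ʳ′ a) bs U p l
      with u∉as , u∉bs ← unique-mid (as ∷ʳ a) U
      with l₁ , l₂ ← linked-++⁻ (as ∷ʳ a) l
      with l₃ , s ← linked-∷ʳ⁻ as l₁
      with a ≟ w
    ... | yes refl = _ , before (as ∷ʳ a) bs p ,
      linked-++⁺ (as ∷ʳ a) (linked-∷ʳ⁺ as (avoid-u u∉as l₃) (R-sym v-w))
        (v-u ∷ u-leave (unique-pair as U ∘ there) u∉bs l₂)
    insert (as ∷ʳ′ a) [] U p l | no a≢w = _ , after (as ∷ʳ a) [] p ,
      linked-++⁺ (as ∷ʳ a) (linked-∷ʳ⁺ as (avoid-u u∉as l₃) (R-sym (u-≢w a≢w (R′-sym s)))) (R-sym v-u ∷ [-])
    insert (as ∷ʳ′ a) (b ∷ bs) U p l | no a≢w with b ≟ w | l₂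
    ... | yes refl | _ ∷ l₄ = _ , after (as ∷ʳ a) (b ∷ bs) p ,
      linked-++⁺ (as ∷ʳ a) (linked-∷ʳ⁺ as (avoid-u u∉as l₃) (R-sym (u-≢w a≢w (R′-sym s)))) (R-sym v-u ∷ v-w ∷ avoid-u u∉bs l₄)
    -- An inner `u` with neither path neighbour equal to `w` would have `t` on both sides, repeating
    -- a vertex.
    ... | no b≢w   | r ∷ _ = contradiction (there (here (u-two a≢w b≢w (R′-sym s) r))) (unique-pair as U)

  cycle-contract : Cycle R W → Cycle R′ W′
  cycle-contract c with rotate c (∈-resp-↭ (↭-sym W↭) (here refl))
  ... | [] , _ , _ , s≤s ()
  ... | a ∷ qs , p , l , n with initLast qs
  ...   | []        = contradiction n λ { (s≤s (s≤s ())) }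
  ...   | ms ∷ʳ′ b with unique-resp-↭ (↭-sym p) unique
  ...     | _ ∷ U with linked-∷ʳ⁻ (v ∷ a ∷ ms) l
  ...       | r ∷ l′ , s =
    a , ms ∷ʳ b , drop-∷ (↭-trans p W↭) ,
    linked-∷ʳ⁺ (a ∷ ms) (avoid-v v∉qs l′) (R′-sym (v-skip a≢b r (R-sym s))) ,
    long ms l′
    where
    v∉qs = unique-head (unique-resp-↭ (↭-sym p) unique)
    a≢b = unique-ends ms U
    -- A triangle through `v` would leave only two vertices; it needs an edge between `u` and `w`,
    -- which `¬u-w` forbids.
    long : ∀ ms → Linked R (a ∷ ms ∷ʳ b) → 3 ≤ length (a ∷ ms ∷ʳ b)
    long []       (r′ ∷ _) with v-two a≢b r (R-sym s)
    ... | inj₁ (refl , refl) = contradiction r′ ¬u-w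
    ... | inj₂ (refl , refl) = contradiction (R-sym r′) ¬u-w
    long (_ ∷ ms) _ = s≤s (s≤s (≤-trans (m≤n+m 1 (length ms)) (≤-reflexive (sym (length-++ ms)))))

  -- Starting at `u` puts its two cycle neighbours first and last in the remaining list. They are
  -- distinct and lie among `w` and `t`, so one of them is `w`, and `v` is inserted on that side.
  cycle-expand : Cycle R′ W′ → Cycle R W
  cycle-expand c with rotate c u∈
  ... | [] , _ , _ , s≤s ()
  ... | b ∷ qs , p , l , n with initLast qs
  ...   | []        = contradiction n λ { (s≤s (s≤s ())) }
  ...   | ms ∷ʳ′ a with unique-resp-↭ (↭-sym p) unique′
  ...     | U@(_ ∷ U′) with linked-∷ʳ⁻ (u ∷ b ∷ ms) l | a ≟ w | b ≟ w
  ...       | r ∷ l′ , s | yes refl | _ =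
    v , u ∷ b ∷ ms ∷ʳ a , ↭-trans (prep v p) (↭-sym W↭) ,
    v-u ∷ linked-∷ʳ⁺ (u ∷ b ∷ ms) (u-≢w (unique-ends ms U′) r ∷ avoid-u (unique-head U) l′) (R-sym v-w) ,
    s≤s (s≤s (s≤s z≤n))
  ...       | r ∷ l′ , s | no a≢w | yes refl =
    u , v ∷ b ∷ ms ∷ʳ a , ↭-trans (↭-swap u v ↭-refl) (↭-trans (prep v p) (↭-sym W↭)) ,
    R-sym v-u ∷ v-w ∷ linked-∷ʳ⁺ (b ∷ ms) (avoid-u (unique-head U) l′) (R-sym (u-≢w a≢w (R′-sym s))) ,
    s≤s (s≤s (s≤s z≤n))
  ...       | r ∷ l′ , s | no a≢w | no b≢w =
    contradiction (u-two b≢w a≢w r (R′-sym s)) (unique-ends ms U′)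

-- Contraction in graphs

private variable
  a b v x y : Vertex
  d f g : Edge
  E : List Edge

Adj : List Edge → Vertex → Vertex → Set
Adj E x y = Any ((x , y) ≈ᵉ_) E

≈ᵉ-trans : d ≈ᵉ f → f ≈ᵉ g → d ≈ᵉ g
≈ᵉ-trans (inj₁ refl) q           = q
≈ᵉ-trans (inj₂ refl) (inj₁ refl) = inj₂ refl
≈ᵉ-trans (inj₂ refl) (inj₂ refl) = inj₁ refl

≈ᵉ-swap : (x , y) ≈ᵉ d → (y , x) ≈ᵉ d
≈ᵉ-swap (inj₁ refl) = inj₂ refl
≈ᵉ-swap (inj₂ refl) = inj₁ refl

Adj-sym : Adj E x y → Adj E y x
Adj-sym = Any.map ≈ᵉ-swap

other-source : ∀ a b → other a (a , b) ≡ b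
other-source a b = cong (when_then b else a) (dec-true (a ≟ a) refl)

other-target : v ≢ a → other v (a , b) ≡ a
other-target {v} {a} {b} v≢a = cong (when_then b else a) (dec-false (v ≟ a) v≢a)

other-≈ : Incident v d → (v , other v d) ≈ᵉ d
other-≈ {v} {_ , b} (inj₁ refl) = inj₁ (cong (v ,_) (other-source v b))
other-≈ {v} {a , b} (inj₂ refl) with v ≟ a
... | yes refl = inj₁ (cong (v ,_) (other-source v v))
... | no v≢a   = inj₂ (cong (v ,_) (other-target v≢a))

≈-other : (x , y) ≈ᵉ d → Incident x d × y ≡ other x d
≈-other {x} {y} (inj₁ refl) = inj₁ refl , sym (other-source x y)
≈-other {x} {y} (inj₂ refl) with x ≟ y
... | yes refl = inj₁ refl , sym (other-source x x)
... | no x≢y   = inj₂ refl , sym (other-target x≢y)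

-- The equation `at` fixes the order of the two edges at `v`. This lets both the degree and
-- `shortcut` be computed from it, at the price that users must consider which neighbour comes
-- first.
record Ends (E : List Edge) (v a b : Vertex) : Set where
  field
    {e e′} : Edge
    at     : filter (incident? v) E ≡ e ∷ e′ ∷ []
    a≡     : a ≡ other v e
    b≡     : b ≡ other v e′

  private
    incident-e : ∀ {f} → f ∈ e ∷ e′ ∷ [] → f ∈ E × Incident v f
    incident-e f∈ = ∈-filter⁻ (incident? v) (subst (_ ∈_) (sym at) f∈)

  e-inc : Incident v e
  e-inc = proj₂ (incident-e (here refl))

  e′-inc : Incident v e′
  e′-inc = proj₂ (incident-e (there (here refl)))

  e∈ : e ∈ E
  e∈ = proj₁ (incident-e (here refl))

  e′∈ : e′ ∈ E
  e′∈ = proj₁ (incident-e (there (here refl)))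

  v-a : Adj E v a
  v-a = lose e∈ (subst (λ x → (v , x) ≈ᵉ e) (sym a≡) (other-≈ e-inc))

  v-b : Adj E v b
  v-b = lose e′∈ (subst (λ x → (v , x) ≈ᵉ e′) (sym b≡) (other-≈ e′-inc))

  only : Adj E v y → y ≡ a ⊎ y ≡ b
  only v-y with f , f∈ , ≈f ← find v-y
           with inc , refl ← ≈-other ≈f
           with subst (f ∈_) at (∈-filter⁺ (incident? v) f∈ inc)
  ... | here refl         = inj₁ (sym a≡)
  ... | there (here refl) = inj₂ (sym b≡)

  shortcut≡ : shortcut v E ≡ (a , b) ∷ []
  shortcut≡ = trans (cong (bypass v) at) (cong₂ (λ x y → (x , y) ∷ []) (sym a≡) (sym b≡))

  -- Equal ends would make the two edges at `v` parallel.
  a≢b : AllPairs (λ e f → ¬ (e ≈ᵉ f)) E → a ≢ b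
  a≢b once refl with (e≉e′ ∷ _) ∷ _ ← subst (AllPairs _) at (AllPairs.filter⁺ (incident? v) once) =
    e≉e′ (≈ᵉ-trans (≈ᵉ-sym (other-≈ e-inc))
      (subst (λ x → (v , x) ≈ᵉ e′) (trans (sym b≡) a≡) (other-≈ e′-inc)))

two-ends : length (filter (incident? v) E) ≡ 2 → ∃[ a ] ∃[ b ] Ends E v a b
two-ends {v} {E} deg with filter (incident? v) E in at
two-ends {v} {E} refl | e ∷ e′ ∷ [] = _ , _ , record { at = at ; a≡ = refl ; b≡ = refl }

module _ {A : Set} {P Q : A → Set} (P? : ∀ x → Dec (P x)) (Q? : ∀ x → Dec (Q x)) where

  length-filter-split : ∀ xs → length (filter P? xs) ≡
    length (filter P? (filter Q? xs)) + length (filter P? (filter (¬? ∘ Q?) xs))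
  length-filter-split [] = refl
  length-filter-split (x ∷ xs) with does (Q? x)
  length-filter-split (x ∷ xs) | true with does (P? x)
  ... | true  = cong suc (length-filter-split xs)
  ... | false = length-filter-split xs
  length-filter-split (x ∷ xs) | false with does (P? x)
  ... | true  = trans (cong suc (length-filter-split xs)) (sym (+-suc _ _))
  ... | false = length-filter-split xs

module _ (ends : Ends E v a b) (a≢b : a ≢ b) where

  open Ends ends hiding (a≢b)

  private
    F = filter (λ e → ¬? (incident? v e)) E

    contract≡ : contractEdges v E ≡ (a , b) ∷ F
    contract≡ = cong (_++ F) shortcut≡

    incident⇒≡ : Incident v f → x ≢ v → Incident x f → x ≡ other v f
    incident⇒≡ (inj₁ refl) x≢v (inj₁ refl) = contradiction refl x≢v
    incident⇒≡ {f} {x} (inj₁ refl) x≢v (inj₂ refl) = proj₂ (≈-other {v} {x} {f} (inj₁ refl))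
    incident⇒≡ {f} {x} (inj₂ refl) x≢v (inj₁ refl) = proj₂ (≈-other {v} {x} {f} (inj₂ refl))
    incident⇒≡ (inj₂ refl) x≢v (inj₂ refl) = contradiction refl x≢v

    ≡⇒incident : Incident v f → x ≡ other v f → Incident x f
    ≡⇒incident inc refl = proj₁ (≈-other (≈ᵉ-swap (other-≈ inc)))

    -- Away from `v`, incidence with `e` means being `a` and incidence with `e′` means being `b`, so
    -- each of these two vertices trades one edge for the new one. Were they equal, a single loop
    -- would stand against two removed edges.
    degree-new : x ≢ v → length (filter (incident? x) (e ∷ e′ ∷ [])) ≡ length (filter (incident? x) ((a , b) ∷ []))
    degree-new {x} x≢v with x ≟ a | x ≟ b
    ... | yes refl | yes refl = contradiction refl a≢b
    ... | yes refl | no x≢b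
      rewrite filter-accept (incident? x) {x = e} {xs = e′ ∷ []} (≡⇒incident e-inc a≡)
            | filter-reject (incident? x) {x = e′} {xs = []} (λ i → x≢b (trans (incident⇒≡ e′-inc x≢v i) (sym b≡)))
            | filter-accept (incident? x) {x = a , b} {xs = []} (inj₁ refl) = refl
    ... | no x≢a | yes refl
      rewrite filter-reject (incident? x) {x = e} {xs = e′ ∷ []} (λ i → x≢a (trans (incident⇒≡ e-inc x≢v i) (sym a≡)))
            | filter-accept (incident? x) {x = e′} {xs = []} (≡⇒incident e′-inc b≡)
            | filter-accept (incident? x) {x = a , b} {xs = []} (inj₂ refl) = refl
    ... | no x≢a | no x≢b
      rewrite filter-reject (incident? x) {x = e} {xs = e′ ∷ []} (λ i → x≢a (trans (incident⇒≡ e-inc x≢v i) (sym a≡)))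
            | filter-reject (incident? x) {x = e′} {xs = []} (λ i → x≢b (trans (incident⇒≡ e′-inc x≢v i) (sym b≡)))
            | filter-reject (incident? x) {x = a , b} {xs = []} [ x≢a , x≢b ]′ = refl

  contract-degree : x ≢ v → length (filter (incident? x) (contractEdges v E)) ≡ length (filter (incident? x) E)
  contract-degree {x} x≢v = begin
    length (filter (incident? x) (contractEdges v E))
      ≡⟨ cong (length ∘ filter (incident? x)) contract≡ ⟩
    length (filter (incident? x) ((a , b) ∷ F))
      ≡⟨ cong length (filter-++ (incident? x) ((a , b) ∷ []) F) ⟩
    length (filter (incident? x) ((a , b) ∷ []) ++ filter (incident? x) F)
      ≡⟨ length-++ (filter (incident? x) ((a , b) ∷ [])) ⟩
    length (filter (incident? x) ((a , b) ∷ [])) + length (filter (incident? x) F)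
      ≡⟨ cong (_+ _) (sym (degree-new x≢v)) ⟩
    length (filter (incident? x) (e ∷ e′ ∷ [])) + length (filter (incident? x) F)
      ≡⟨ cong (λ l → length (filter (incident? x) l) + length (filter (incident? x) F)) at ⟨
    length (filter (incident? x) (filter (incident? v) E)) + length (filter (incident? x) F)
      ≡⟨ length-filter-split (incident? x) (incident? v) E ⟨
    length (filter (incident? x) E) ∎
    where open ≡-Reasoning

  contract-a-b : Adj (contractEdges v E) a b
  contract-a-b = subst (λ E → Adj E a b) (sym contract≡) (here (inj₁ refl))

  contract⁺ : x ≢ v → y ≢ v → Adj E x y → Adj (contractEdges v E) x y
  contract⁺ {x} {y} x≢v y≢v x-y with f , f∈ , ≈f ← find x-y =
    subst (λ E → Adj E x y) (sym contract≡)
      (there (lose (∈-filter⁺ (λ e → ¬? (incident? v e)) f∈ (avoid ≈f)) ≈f))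
    where
    avoid : (x , y) ≈ᵉ f → ¬ Incident v f
    avoid (inj₁ refl) (inj₁ refl) = x≢v refl
    avoid (inj₁ refl) (inj₂ refl) = y≢v refl
    avoid (inj₂ refl) (inj₁ refl) = y≢v refl
    avoid (inj₂ refl) (inj₂ refl) = x≢v refl

  contract⁻ : Adj (contractEdges v E) x y → Adj E x y ⊎ (x ≡ a × y ≡ b) ⊎ (x ≡ b × y ≡ a)
  contract⁻ {x} {y} x-y with subst (λ E → Adj E x y) contract≡ x-y
  ... | here (inj₁ refl) = inj₂ (inj₁ (refl , refl))
  ... | here (inj₂ refl) = inj₂ (inj₂ (refl , refl))
  ... | there x-y′ with f , f∈ , ≈f ← find x-y′ =
    inj₁ (lose (proj₁ (∈-filter⁻ (λ e → ¬? (incident? v e)) f∈)) ≈f)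

-- Valid instances

-- The invariants of a graph, its boundary and its solution, stated for the bare lists on which
-- `kernel` computes. `X` is a parameter because contraction leaves the solution untouched.
record Valid (B X : FinSet) (G : List Vertex × List Edge) : Set where
  field
    uniqueᵛ  : Unique (proj₁ G)
    endpointsᵛ : All (λ e → proj₁ e ∈ proj₁ G × proj₂ e ∈ proj₁ G) (proj₂ G)
    looplessᵛ  : All (λ e → proj₁ e ≢ proj₂ e) (proj₂ G)
    onceᵛ      : AllPairs (λ e f → ¬ (e ≈ᵉ f)) (proj₂ G)
    boundaryᵛ  : ∀ {v} → v ∈ˢ B → v ∈ proj₁ G
    subsetᵛ    : ∀ {v} → v ∈ˢ X → v ∈ proj₁ G
    degreeTwoᵛ : ∀ {v} → v ∈ proj₁ G → v ∉ˢ X → length (filter (incident? v) (proj₂ G)) ≡ 2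

  boundaried : Boundaried B
  boundaried = record
    { graph    = record
      { vertices  = finSet (proj₁ G) uniqueᵛ
      ; edges     = proj₂ G
      ; endpoints = endpointsᵛ
      ; loopless  = looplessᵛ
      ; once      = onceᵛ
      }
    ; boundary = boundaryᵛ
    }

  solutionSet : DegreeTwoOutside (graph boundaried)
  solutionSet = record { set = X ; subset = subsetᵛ ; degreeTwo = degreeTwoᵛ }

  adj-∈ : Adj (proj₂ G) x y → x ∈ proj₁ G
  adj-∈ x-y with f , f∈ , ≈f ← find x-y with ≈f | All.lookup endpointsᵛ f∈
  ... | inj₁ refl | p , _ = p
  ... | inj₂ refl | _ , q = q

  adj-≢ : Adj (proj₂ G) x y → x ≢ y
  adj-≢ x-y refl with f , f∈ , ≈f ← find x-y with ≈f
  ... | inj₁ refl = All.lookup looplessᵛ f∈ refl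
  ... | inj₂ refl = All.lookup looplessᵛ f∈ refl

open Valid

protected : FinSet → FinSet → List Vertex
protected B X = elements X ++ elements B

module _ {B X : FinSet} {V : List Vertex} {E : List Edge} (G : Valid B X (V , E)) where

  record Contractible (v : Vertex) : Set where
    field
      {u w} : Vertex
      ends  : Ends E v u w
      v∉ : v ∉ protected B X
      u∉ : u ∉ protected B X
      w∉ : w ∉ protected B X
      ¬u-w  : ¬ Adj E u w

    u≢w : u ≢ w
    u≢w = Ends.a≢b ends (onceᵛ G)

  neighbours : v ∈ V → v ∉ protected B X → ∃[ a ] ∃[ b ] Ends E v a b
  neighbours v∈ v∉ = two-ends (degreeTwoᵛ G v∈ (v∉ ∘ ∈-++⁺ˡ))

  contractible : v ∈ V → Reducible (protected B X) E v → Contractible v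
  contractible v∈ (v∉ , red) with u , w , es ← neighbours v∈ v∉
    with subst (Any _) (Ends.shortcut≡ es) red
  ... | here (u∉ , w∉ , ¬u-w) = record { ends = es ; v∉ = v∉ ; u∉ = u∉ ; w∉ = w∉ ; ¬u-w = ¬u-w }

  contract-valid : v ∈ V → Contractible v → Valid B X (contract v (V , E))
  contract-valid {v} v∈ c = record
    { uniqueᵛ  = Unique.filter⁺ (λ x → ¬? (x ≟ v)) (uniqueᵛ G)
    ; endpointsᵛ = subst (All _) (cong (_++ F) (sym shortcut≡))
        ((keep (λ { refl → adj-≢ G v-a refl }) (adj-∈ G (Adj-sym v-a)) , keep (λ { refl → adj-≢ G v-b refl }) (adj-∈ G (Adj-sym v-b)))
        ∷ All.tabulate λ f∈ → let f∈E , ¬inc = ∈-filter⁻ ¬inc? f∈ ; p , q = All.lookup (endpointsᵛ G) f∈E in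
            keep (λ { refl → ¬inc (inj₁ refl) }) p , keep (λ { refl → ¬inc (inj₂ refl) }) q)
    ; looplessᵛ  = subst (All _) (cong (_++ F) (sym shortcut≡)) (u≢w ∷ All.filter⁺ ¬inc? (looplessᵛ G))
    -- The new edge repeats no old one precisely because `u` and `w` are not adjacent.
    ; onceᵛ      = subst (AllPairs _) (cong (_++ F) (sym shortcut≡))
        (All.filter⁺ ¬inc? (All.¬Any⇒All¬ E ¬u-w) ∷ AllPairs.filter⁺ ¬inc? (onceᵛ G))
    ; boundaryᵛ  = λ x∈ → keep (λ { refl → v∉ (∈-++⁺ʳ (elements X) x∈) }) (boundaryᵛ G x∈)
    ; subsetᵛ    = λ x∈ → keep (λ { refl → v∉ (∈-++⁺ˡ x∈) }) (subsetᵛ G x∈)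
    ; degreeTwoᵛ = λ x∈ x∉ → let x∈V , x≢v = ∈-filter⁻ (λ x → ¬? (x ≟ v)) x∈ in
        trans (contract-degree ends u≢w x≢v) (degreeTwoᵛ G x∈V x∉)
    }
    where
    open Contractible c
    open Ends ends hiding (a≢b)
    ¬inc? = λ e → ¬? (incident? v e)
    F = filter ¬inc? E
    keep : x ≢ v → x ∈ V → x ∈ filter (λ x → ¬? (x ≟ v)) V
    keep x≢v x∈ = ∈-filter⁺ (λ x → ¬? (x ≟ v)) x∈ x≢v

-- Contraction in gluings

unique-↭ : {xs ys : List A} → Unique xs → Unique ys → (∀ {x} → x ∈ xs → x ∈ ys) → (∀ {x} → x ∈ ys → x ∈ xs) → xs ↭ ys
unique-↭ U U′ to from = ∼bag⇒↭ (unique∧set⇒bag U U′ (mk⇔ to from))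

∈-∪⁻ : ∀ A B → x ∈ˢ A ∪ˢ B → x ∈ˢ A ⊎ x ∈ˢ B
∈-∪⁻ A B x∈ with ∈-++⁻ (elements A) x∈
... | inj₁ x∈A = inj₁ x∈A
... | inj₂ x∈  = inj₂ (proj₁ (∈-filter⁻ (λ v → ¬? (v ∈? elements A)) x∈))

module _ (G H : Graph) where

  private
    new? = λ e → ¬? (any? (e ≈ᵉ?_) (edges G))

  adjacent-∪⁻ : Adjacent (G ∪ᵍ H) x y → Adjacent G x y ⊎ Adjacent H x y
  adjacent-∪⁻ x-y with Any.++⁻ (edges G) x-y
  ... | inj₁ x-y   = inj₁ x-y
  ... | inj₂ x-y with f , f∈ , ≈f ← find x-y = inj₂ (lose (proj₁ (∈-filter⁻ new? f∈)) ≈f)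

  adjacent-∪⁺ˡ : Adjacent G x y → Adjacent (G ∪ᵍ H) x y
  adjacent-∪⁺ˡ = Any.++⁺ˡ

  adjacent-∪⁺ʳ : Adjacent H x y → Adjacent (G ∪ᵍ H) x y
  adjacent-∪⁺ʳ x-y with f , f∈ , ≈f ← find x-y with any? (f ≈ᵉ?_) (edges G)
  ... | yes old = Any.++⁺ˡ (Any.map (≈ᵉ-trans ≈f) old)
  ... | no new  = Any.++⁺ʳ (edges G) (lose (∈-filter⁺ new? f∈ new) ≈f)

adjacent-∈ : ∀ G → Adjacent G x y → x ∈ˢ vertices G
adjacent-∈ G x-y with f , f∈ , ≈f ← find x-y with ≈f | All.lookup (endpoints G) f∈
... | inj₁ refl | p , _ = p
... | inj₂ refl | _ , q = q

-- Unlike `HamiltonianPath`, this admits the empty path, so that lists can be split and spliced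
-- without keeping track of a head; any known vertex restores nonemptiness.
HamPath : Problem
HamPath G = Path (Adjacent G) (elements (vertices G))

hamPath⁺ : ∀ G → HamiltonianPath G → HamPath G
hamPath⁺ G (v , vs , p , l) = v ∷ vs , p , l

hamPath⁻ : ∀ G → x ∈ˢ vertices G → HamPath G → HamiltonianPath G
hamPath⁻ G x∈ (v ∷ vs , p , l) = v , vs , p , l
hamPath⁻ G x∈ ([] , p , l) with ∈-resp-↭ (↭-sym p) x∈
... | ()

module _ {B X : FinSet} {V : List Vertex} {E : List Edge} (G : Valid B X (V , E))
         {v : Vertex} (v∈ : v ∈ V) (c : Contractible G v)
         (H : Graph) (glu : ∀ {x} → x ∈ V → x ∈ˢ vertices H → x ∈ˢ B) where

  open Contractible c
  open Ends ends using (v-a; v-b; only)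

  private
    G′ = contract-valid G v∈ c
    GH  = graph (boundaried G) ∪ᵍ H
    G′H = graph (boundaried G′) ∪ᵍ H
    V′ = filter (λ x → ¬? (x ≟ v)) V

    private-vertex : ∀ {x} → x ∈ V → x ∉ protected B X → x ∉ˢ vertices H
    private-vertex x∈ x∉ x∈H = x∉ (∈-++⁺ʳ (elements X) (glu x∈ x∈H))

    G-only : ∀ {x y} → x ∈ V → x ∉ protected B X → Adjacent GH x y → Adj E x y
    G-only x∈ x∉ x-y = [ (λ r → r) ,
      (λ r → contradiction (adjacent-∈ H r) (private-vertex x∈ x∉)) ]′ (adjacent-∪⁻ (graph (boundaried G)) H x-y)

    u∈ : u ∈ V
    u∈ = adj-∈ G (Adj-sym v-a)

    u≢v : u ≢ v
    u≢v refl = adj-≢ G v-a refl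

    u∈V′ : u ∈ V′
    u∈V′ = ∈-filter⁺ (λ x → ¬? (x ≟ v)) u∈ u≢v

    -- As `u` is outside `P`, it has two neighbours in the contracted graph as well. One is `w`, by
    -- the new edge; `t` is the one that remains, whichever is listed first.
    other-end : ∃[ t ] (∀ {y} → Adj (contractEdges v E) u y → y ≡ w ⊎ y ≡ t)
    other-end with a , b , es ← neighbours G′ u∈V′ u∉
              with Ends.only es (contract-a-b ends u≢w)
    ... | inj₁ refl = b , Ends.only es
    ... | inj₂ refl = a , λ u-y → [ inj₂ , inj₁ ]′ (Ends.only es u-y)

    t = proj₁ other-end

    vertices-↭ : elements (vertices GH) ↭ v ∷ elements (vertices G′H)
    vertices-↭ = unique-↭ (distinct (vertices GH))
      (All.tabulate (λ { x∈ refl → v∉W′ x∈ }) ∷ distinct (vertices G′H)) to from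
      where
      VG = finSet V (uniqueᵛ G)
      VG′ = finSet V′ (uniqueᵛ G′)
      v∉W′ : v ∉ elements (vertices G′H)
      v∉W′ x∈ with ∈-∪⁻ VG′ (vertices H) x∈
      ... | inj₁ v∈V′ = proj₂ (∈-filter⁻ (λ x → ¬? (x ≟ v)) {xs = V} v∈V′) refl
      ... | inj₂ v∈H  = private-vertex v∈ v∉ v∈H
      to : ∀ {x} → x ∈ elements (vertices GH) → x ∈ v ∷ elements (vertices G′H)
      to {x} x∈ with ∈-∪⁻ VG (vertices H) x∈ | x ≟ v
      ... | _        | yes refl = here refl
      ... | inj₁ x∈V | no x≢v   = there (⊆-∪ˡ VG′ (vertices H) (∈-filter⁺ (λ x → ¬? (x ≟ v)) x∈V x≢v))
      ... | inj₂ x∈H | no x≢v   = there (⊆-∪ʳ VG′ (vertices H) x∈H)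
      from : ∀ {x} → x ∈ v ∷ elements (vertices G′H) → x ∈ elements (vertices GH)
      from (here refl) = ⊆-∪ˡ VG (vertices H) v∈
      from (there x∈) with ∈-∪⁻ VG′ (vertices H) x∈
      ... | inj₁ x∈V′ = ⊆-∪ˡ VG (vertices H) (proj₁ (∈-filter⁻ (λ x → ¬? (x ≟ v)) x∈V′))
      ... | inj₂ x∈H  = ⊆-∪ʳ VG (vertices H) x∈H

    contraction : Contraction (Adjacent GH) (Adjacent G′H) v u w t
    contraction = record
      { R-sym   = Adj-sym
      ; R′-sym  = Adj-sym
      ; R⇒R′    = λ a≢v b≢v r → [ adjacent-∪⁺ˡ G′ᵍ H ∘ contract⁺ ends u≢w a≢v b≢v ,
                              adjacent-∪⁺ʳ G′ᵍ H ]′ (adjacent-∪⁻ Gᵍ H r)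
      ; R′⇒R    = λ r → [ (λ s → [ inj₁ ∘ adjacent-∪⁺ˡ Gᵍ H , inj₂ ]′ (contract⁻ ends u≢w s)) ,
                    inj₁ ∘ adjacent-∪⁺ʳ Gᵍ H ]′ (adjacent-∪⁻ G′ᵍ H r)
      ; v-u     = adjacent-∪⁺ˡ Gᵍ H v-a
      ; v-w     = adjacent-∪⁺ˡ Gᵍ H v-b
      ; v-only  = only ∘ G-only v∈ v∉
      ; u′-w    = adjacent-∪⁺ˡ G′ᵍ H (contract-a-b ends u≢w)
      ; u′-only = λ r → [ proj₂ other-end ,
                    (λ s → contradiction (adjacent-∈ H s) (private-vertex u∈ u∉)) ]′ (adjacent-∪⁻ G′ᵍ H r)
      ; u≢w     = u≢w
      ; ¬u-w    = ¬u-w ∘ G-only u∈ u∉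
      }
      where
      Gᵍ = graph (boundaried G)
      G′ᵍ = graph (boundaried G′)

    u∈W′ : u ∈ˢ vertices G′H
    u∈W′ = ⊆-∪ˡ (finSet V′ (uniqueᵛ G′)) (vertices H) u∈V′

    u∈W : u ∈ˢ vertices GH
    u∈W = ⊆-∪ˡ (finSet V (uniqueᵛ G)) (vertices H) u∈

  contract-path : HamiltonianPath GH ⇔ HamiltonianPath G′H
  contract-path = mk⇔
    (hamPath⁻ G′H u∈W′ ∘ path-contract contraction vertices-↭ (distinct (vertices GH)) u∈W′ ∘ hamPath⁺ GH)
    (hamPath⁻ GH u∈W ∘ path-expand contraction vertices-↭ (distinct (vertices GH)) u∈W′ ∘ hamPath⁺ G′H)

  contract-cycle : HamiltonianCycle GH ⇔ HamiltonianCycle G′H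
  contract-cycle = mk⇔
    (cycle-contract contraction vertices-↭ (distinct (vertices GH)) u∈W′)
    (cycle-expand contraction vertices-↭ (distinct (vertices GH)) u∈W′)

-- Bounding the number of vertices outside P

unique-++ʳ : ∀ {A : Set} (xs : List A) {ys} → Unique (xs ++ ys) → Unique ys
unique-++ʳ []       U       = U
unique-++ʳ (x ∷ xs) (_ ∷ U) = unique-++ʳ xs U

unique-length : ∀ {A : Set} {xs ys : List A} → Unique xs → (∀ {x} → x ∈ xs → x ∈ ys) → length xs ≤ length ys
unique-length {xs = []} U ⊆ = z≤n
unique-length {xs = x ∷ xs} (x∉ ∷ U) ⊆ with as , bs , refl ← ∈-∃++ (⊆ (here refl)) = begin
  suc (length xs)         ≤⟨ s≤s (unique-length U avoid) ⟩
  suc (length (as ++ bs)) ≡⟨ cong suc (length-++ as) ⟩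
  suc (length as + length bs) ≡⟨ +-suc (length as) (length bs) ⟨
  length as + suc (length bs) ≡⟨ length-++ as ⟨
  length (as ++ x ∷ bs)   ∎
  where
  open ≤-Reasoning
  avoid : ∀ {y} → y ∈ xs → y ∈ as ++ bs
  avoid y∈ with ∈-++⁻ as (⊆ (there y∈))
  ... | inj₁ y∈as         = ∈-++⁺ˡ y∈as
  ... | inj₂ (here refl)  = contradiction refl (All.lookup x∉ y∈)
  ... | inj₂ (there y∈bs) = ∈-++⁺ʳ as y∈bs

module _ {A : Set} {O P : A → Set} (O? : ∀ x → Dec (O x)) (P? : ∀ x → Dec (P x))
         {R : A → A → Set} (near : ∀ {x y} → R x y → O y → O x ⊎ P x) where

  NoTriple : List A → Set
  NoTriple p = ∀ as {a b c bs} → p ≡ as ++ a ∷ b ∷ c ∷ bs → O a → O b → ¬ O c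

  private
    noTriple-tail : ∀ {x p} → NoTriple (x ∷ p) → NoTriple p
    noTriple-tail nt as eq = nt (_ ∷ as) (cong (_ ∷_) eq)

    #O #P : List A → ℕ
    #O p = length (filter O? p)
    #P p = length (filter P? p)

    #P-∷ : ∀ x p → #P p ≤ #P (x ∷ p)
    #P-∷ x p with P? x
    ... | yes _ = n≤1+n _
    ... | no _  = ≤-refl

    #O-∷ : ∀ x p → #O (x ∷ p) ≤ suc (#O p)
    #O-∷ x p with O? x
    ... | yes _ = ≤-refl
    ... | no _  = n≤1+n _

  -- Between two elements of P there are at most two elements of O.
  count-O : ∀ p → Linked R p → NoTriple p → #O p ≤ 2 + 2 * #P p

  private
    -- By `near`, an element of `O` following one outside `O` must follow an element of `P`. So no
    -- run of `O` begins before the next element of `P`, which pays for that run, and the additive 2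
    -- of `count-O` disappears.
    count-other : ∀ x p → ¬ O x → Linked R (x ∷ p) → NoTriple (x ∷ p) → #O (x ∷ p) ≤ 2 * #P (x ∷ p)
    count-other x p ¬Ox l nt with O? x | P? x
    ... | yes Ox | _ = contradiction Ox ¬Ox
    ... | no _ | yes _ = ≤-trans (count-O p (tail l) (noTriple-tail nt)) (≤-reflexive (lemma (#P p)))
      where
      lemma : ∀ n → 2 + 2 * n ≡ 2 * suc n
      lemma = solve-∀
    count-other x []      ¬Ox l nt       | no _ | no _ = z≤n
    count-other x (y ∷ p) ¬Ox (r ∷ l) nt | no _ | no ¬Px =
      count-other y p (λ Oy → [ ¬Ox , ¬Px ]′ (near r Oy)) l (noTriple-tail nt)

  count-O []      l nt = z≤n
  count-O (x ∷ p) l nt = cases p (O? x) l nt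
    where
    skip : ∀ {m} x p → m ≤ 2 * #P p → m ≤ 2 * #P (x ∷ p)
    skip x p m≤ = ≤-trans m≤ (*-monoʳ-≤ 2 (#P-∷ x p))
    -- Two elements of `O` have been seen, so the next one is not in `O` and the sharper bound of
    -- `count-other` applies.
    cases₃ : ∀ y p → O x → O y → Linked R (y ∷ p) → NoTriple (x ∷ y ∷ p) → #O p ≤ 2 * #P p
    cases₃ y []      Ox Oy l       nt = z≤n
    cases₃ y (z ∷ p) Ox Oy (_ ∷ l) nt = count-other z p (nt [] refl Ox Oy) l (noTriple-tail (noTriple-tail nt))
    cases₂ : ∀ y p → Dec (O y) → O x → Linked R (y ∷ p) → NoTriple (x ∷ y ∷ p) → #O (y ∷ p) ≤ 1 + 2 * #P (y ∷ p)
    cases₂ y p (no ¬Oy) Ox l nt = ≤-trans (count-other y p ¬Oy l (noTriple-tail nt)) (n≤1+n _)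
    cases₂ y p (yes Oy) Ox l nt = ≤-trans (#O-∷ y p) (s≤s (skip y p (cases₃ y p Ox Oy l nt)))
    cases₁ : ∀ p → O x → Linked R (x ∷ p) → NoTriple (x ∷ p) → #O p ≤ 1 + 2 * #P p
    cases₁ []      Ox l       nt = z≤n
    cases₁ (y ∷ p) Ox (_ ∷ l) nt = cases₂ y p (O? y) Ox l nt
    cases : ∀ p → Dec (O x) → Linked R (x ∷ p) → NoTriple (x ∷ p) → #O (x ∷ p) ≤ 2 + 2 * #P (x ∷ p)
    cases p (no ¬Ox) l nt = ≤-trans (count-other x p ¬Ox l nt) (m≤n+m _ 2)
    cases p (yes Ox) l nt = ≤-trans (#O-∷ x p) (s≤s (≤-trans (cases₁ p Ox l nt) (s≤s (*-monoʳ-≤ 2 (#P-∷ x p)))))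

module _ {B X : FinSet} {V : List Vertex} {E : List Edge} (G : Valid B X (V , E))
         (irreducible : filter (reducible? (protected B X) E) V ≡ [])
         (H : Graph) (glu : ∀ {x} → x ∈ V → x ∈ˢ vertices H → x ∈ˢ B) where

  private
    P = protected B X
    N = outside P V
    Gᵍ = graph (boundaried G)
    GH = Gᵍ ∪ᵍ H

    N⁻ : ∀ {x} → x ∈ N → x ∈ V × x ∉ P
    N⁻ = ∈-filter⁻ (λ v → ¬? (v ∈? P))

    N⁺ : ∀ {x} → x ∈ V → x ∉ P → x ∈ N
    N⁺ = ∈-filter⁺ (λ v → ¬? (v ∈? P))

    N-unique : Unique N
    N-unique = Unique.filter⁺ (λ v → ¬? (v ∈? P)) (uniqueᵛ G)

    N⊆ : ∀ {p x} → p ↭ elements (vertices GH) → x ∈ N → x ∈ p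
    N⊆ p↭ x∈ = ∈-resp-↭ (↭-sym p↭) (⊆-∪ˡ (vertices Gᵍ) (vertices H) (proj₁ (N⁻ x∈)))

    N-only : ∀ {x y} → x ∈ N → Adjacent GH x y → Adj E x y
    N-only x∈ x-y with adjacent-∪⁻ Gᵍ H x-y
    ... | inj₁ r = r
    ... | inj₂ r = contradiction (∈-++⁺ʳ (elements X) (glu (proj₁ (N⁻ x∈)) (adjacent-∈ H r))) (proj₂ (N⁻ x∈))

    two-of : ∀ {v x y z} → v ∈ N → x ≢ y → Adj E v x → Adj E v y → Adj E v z → z ≡ x ⊎ z ≡ y
    two-of v∈ x≢y v-x v-y v-z
      with a , b , es ← neighbours G (proj₁ (N⁻ v∈)) (proj₂ (N⁻ v∈))
      with Ends.only es v-x | Ends.only es v-y | Ends.only es v-z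
    ... | inj₁ refl | inj₁ refl | _       = contradiction refl x≢y
    ... | inj₂ refl | inj₂ refl | _       = contradiction refl x≢y
    ... | inj₁ refl | inj₂ refl | r       = r
    ... | inj₂ refl | inj₁ refl | inj₁ eq = inj₂ eq
    ... | inj₂ refl | inj₁ refl | inj₂ eq = inj₁ eq

    -- If `x` and `y` were not adjacent, `v` would be reducible and hence occur in a list that
    -- irreducibility makes empty.
    joined : ∀ {v x y} → v ∈ N → Ends E v x y → x ∈ N → y ∈ N → Adj E x y
    joined {v} {x} {y} v∈ es x∈ y∈ = decidable-stable (any? ((x , y) ≈ᵉ?_) E) ¬¬x-y
      where
      ¬¬x-y : ¬ ¬ Adj E x y
      ¬¬x-y ¬x-y with subst (v ∈_) irreducible (∈-filter⁺ (reducible? P E) (proj₁ (N⁻ v∈))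
        (proj₂ (N⁻ v∈) , subst (Any _) (sym (Ends.shortcut≡ es)) (here (proj₂ (N⁻ x∈) , proj₂ (N⁻ y∈) , ¬x-y))))
      ... | ()

    triangle : ∀ {a b c} → a ∈ N → b ∈ N → c ∈ N → a ≢ c → Adj E a b → Adj E b c → Adj E a c
    triangle a∈ b∈ c∈ a≢c a-b b-c
      with x , y , es ← neighbours G (proj₁ (N⁻ b∈)) (proj₂ (N⁻ b∈))
      with Ends.only es (Adj-sym a-b) | Ends.only es b-c
    ... | inj₁ refl | inj₁ refl = contradiction refl a≢c
    ... | inj₂ refl | inj₂ refl = contradiction refl a≢c
    ... | inj₁ refl | inj₂ refl = joined b∈ es a∈ c∈
    ... | inj₂ refl | inj₁ refl = Adj-sym (joined b∈ es c∈ a∈)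

    near : ∀ {x y} → Adjacent GH x y → y ∈ N → x ∈ N ⊎ x ∈ P
    near {x} x-y y∈ with x ∈? P
    ... | yes x∈P = inj₂ x∈P
    ... | no x∉P  = inj₁ (N⁺ (adj-∈ G (Adj-sym (N-only y∈ (Adj-sym x-y)))) x∉P)

    -- Three consecutive outside vertices form a triangle component.
    noTriple : ∀ {p} → Unique p → Linked (Adjacent GH) p → length p ≢ 3 → NoTriple (_∈? N) (_∈? P) near p
    noTriple U l ≢3 as {a} {b} {c} {bs} refl a∈ b∈ c∈ = impossible (initLast as) bs U l ≢3
      where
      impossible : ∀ {as} → InitLast as → ∀ bs → Unique (as ++ a ∷ b ∷ c ∷ bs) →
                   Linked (Adjacent GH) (as ++ a ∷ b ∷ c ∷ bs) → length (as ++ a ∷ b ∷ c ∷ bs) ≢ 3 → ⊥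
      impossible {as} il bs U l ≢3 with linked-++⁻ as l | unique-++ʳ as U
      ... | l₁ , ab ∷ bc ∷ l₂ | (a≢b ∷ a≢c ∷ a∉) ∷ (b≢c ∷ b∉) ∷ _ = ends-here il bs U ≢3 l₁ l₂ a∉ b∉
        where
        a-b = N-only a∈ ab
        b-c = N-only b∈ bc
        a-c = triangle a∈ b∈ c∈ a≢c a-b b-c
        ends-here : ∀ {as} → InitLast as → ∀ bs → Unique (as ++ a ∷ b ∷ c ∷ bs) → length (as ++ a ∷ b ∷ c ∷ bs) ≢ 3 →
                    Linked (Adjacent GH) (as ∷ʳ a) → Linked (Adjacent GH) (c ∷ bs) → All (a ≢_) bs → All (b ≢_) bs → ⊥
        -- The vertex `c` already has `a` and `b` as its two neighbours, so the path cannot go on to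
        -- a new vertex; the same holds before `a`.
        ends-here _ (d ∷ bs) U ≢3 l₁ (cd ∷ _) (a≢d ∷ _) (b≢d ∷ _) =
          [ (λ { refl → a≢d refl }) , (λ { refl → b≢d refl }) ]′
            (two-of c∈ a≢b (Adj-sym a-c) (Adj-sym b-c) (N-only c∈ cd))
        ends-here [] [] U ≢3 _ _ _ _ = ≢3 refl
        ends-here (as ∷ʳ′ z) [] U ≢3 l₁ _ _ _ = unique-pair as U (there (member
          (two-of a∈ b≢c a-b a-c (N-only a∈ (Adj-sym (proj₂ (linked-∷ʳ⁻ as l₁)))))))
          where
          member : z ≡ b ⊎ z ≡ c → z ∈ b ∷ c ∷ []
          member (inj₁ refl) = here refl
          member (inj₂ refl) = there (here refl)

  few-outside : HamPath GH → length N ≤ 2 * length P + 3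
  few-outside (p , p↭ , l) with length p ≟ 3
  -- Only a path of exactly three vertices can contain a triple of outside vertices. This case turns
  -- the additive 2 of `count-O` into a 3.
  ... | yes ≡3 = ≤-trans (≤-trans (unique-length N-unique (N⊆ p↭)) (≤-reflexive ≡3)) (m≤n+m 3 _)
  ... | no ≢3 = begin
    length N                          ≤⟨ unique-length N-unique (λ x∈ → ∈-filter⁺ (_∈? N) (N⊆ p↭ x∈) x∈) ⟩
    length (filter (_∈? N) p)         ≤⟨ count-O (_∈? N) (_∈? P) near p l (noTriple U l ≢3) ⟩
    2 + 2 * length (filter (_∈? P) p) ≤⟨ ≤-trans (n≤1+n _) (+-monoʳ-≤ 3 (*-monoʳ-≤ 2 P-count)) ⟩
    3 + 2 * length P                  ≡⟨ +-comm 3 _ ⟩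
    2 * length P + 3                  ∎
    where
    open ≤-Reasoning
    U : Unique p
    U = unique-resp-↭ (↭-sym p↭) (distinct (vertices GH))
    P-count : length (filter (_∈? P) p) ≤ length P
    P-count = unique-length (Unique.filter⁺ (_∈? P) U) (λ x∈ → proj₂ (∈-filter⁻ (_∈? P) {xs = p} x∈))

module _ {A : Set} {R : A → A → Set} (R-sym : ∀ {x y} → R x y → R y x) where

  -- Used contrapositively: an isolated vertex rules out a Hamiltonian path as soon as there is a
  -- second vertex.
  has-neighbour : ∀ {x y p} → Linked R p → x ∈ p → y ∈ p → x ≢ y → ∃[ z ] R x z
  has-neighbour {x} l x∈ y∈ x≢y with as , bs , refl ← ∈-∃++ x∈ = search (initLast as) bs l y∈
    where
    search : ∀ {as} → InitLast as → ∀ bs → Linked R (as ++ x ∷ bs) → _ ∈ as ++ x ∷ bs → ∃[ z ] R x z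
    search il         (b ∷ bs) l _ with _ , r ∷ _ ← linked-++⁻ _ l = b , r
    search []         []       l (here refl) = contradiction refl x≢y
    search (as ∷ʳ′ a) []       l _ with l₁ , _ ← linked-++⁻ (as ∷ʳ a) l = a , R-sym (proj₂ (linked-∷ʳ⁻ as l₁))

-- Correctness of the kernelization

-- The kernelization counts to twice the length of `P` by folding over `P`, without computing a
-- number; this recovers the arithmetic.
drop-twos : ∀ {A B : Set} (xs : List A) (ys : List B) → foldr (λ _ → drop 2) xs ys ≡ drop (2 * length ys) xs
drop-twos xs []       = refl
drop-twos xs (y ∷ ys) = trans (cong (drop 2) (drop-twos xs ys))
  (trans (drop-drop (2 * length ys) 2 xs) (cong (λ n → drop n xs) (lemma (length ys))))
  where
  lemma : ∀ n → 2 * n + 2 ≡ 2 * suc n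
  lemma = solve-∀

∈-drop : ∀ {A : Set} n {x : A} xs → x ∈ drop n xs → x ∈ xs
∈-drop zero    xs       x∈ = x∈
∈-drop (suc n) (_ ∷ xs) x∈ = there (∈-drop n xs x∈)

surplus≡ : ∀ P V → surplus P V ≡ drop (2 + 2 * length P) (outside P V)
surplus≡ P V = trans (drop-twos (drop 2 (outside P V)) P) (drop-drop 2 (2 * length P) (outside P V))

length-surplus : ∀ P V → length (surplus P V) ≡ length (outside P V) ∸ (2 + 2 * length P)
length-surplus P V = trans (cong length (surplus≡ P V)) (length-drop (2 + 2 * length P) (outside P V))

-- Both problems enter the argument through two facts only: contraction preserves them in every
-- gluing, and a yes-instance has a Hamiltonian path.
module _ (Π : Problem)
  (contract⇔ : ∀ {B X V E} (G : Valid B X (V , E)) {v} (v∈ : v ∈ V) (c : Contractible G v)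
    (H : Graph) (glu : ∀ {x} → x ∈ V → x ∈ˢ vertices H → x ∈ˢ B) →
    Π (graph (boundaried G) ∪ᵍ H) ⇔ Π (graph (boundaried (contract-valid G v∈ c)) ∪ᵍ H))
  (Π⇒path : ∀ G → Π G → HamPath G) where

  module _ {B X : FinSet} {V : List Vertex} {E : List Edge} (G : Valid B X (V , E)) where

    private
      P = protected B X

    EquivalentTo : ∀ {X′ S} → Valid B X′ S → Set
    EquivalentTo G′ = ∀ H → (∀ {x} → x ∈ V → x ∈ˢ vertices H → x ∈ˢ B) →
      Π (graph (boundaried G) ∪ᵍ H) ⇔ Π (graph (boundaried G′) ∪ᵍ H)

    -- Equivalence is stated for all `H` meeting the original `V` inside `B`. By `⊆V` these also
    -- meet every later vertex list inside `B`, so the equivalences compose along a sequence of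
    -- contractions.
    record Reduct (S : List Vertex × List Edge) : Set where
      field
        valid : Valid B X S
        ⊆V    : ∀ {x} → x ∈ proj₁ S → x ∈ V
        equiv : EquivalentTo valid

    open Reduct

    reduct-contract : ∀ {S v} (r : Reduct S) → v ∈ proj₁ S → Contractible (valid r) v → Reduct (contract v S)
    reduct-contract {S} {v} r v∈ c = record
      { valid = contract-valid (valid r) v∈ c
      ; ⊆V    = λ x∈ → ⊆V r (proj₁ (∈-filter⁻ (λ x → ¬? (x ≟ v)) {xs = proj₁ S} x∈))
      ; equiv = λ H glu → ⇔-trans (equiv r H glu) (contract⇔ (valid r) v∈ c H (glu ∘ ⊆V r))
      }
      where
      ⇔-trans : ∀ {A B C : Set} → A ⇔ B → B ⇔ C → A ⇔ C
      ⇔-trans = IsEquivalence.trans ⇔-isEquivalence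

    Irreducible : List Vertex × List Edge → Set
    Irreducible (V , E) = filter (reducible? P E) V ≡ []

    -- Every contraction deletes a vertex, and an irreducible graph is left alone. After as many
    -- rounds as there were vertices, the graph is therefore irreducible or has no vertices, and
    -- then it is irreducible trivially.
    reduct-once : ∀ {S n} → Reduct S → Irreducible S ⊎ length (proj₁ S) + n ≤ length V →
                  Reduct (reduceOnce P S) ×
                  (Irreducible (reduceOnce P S) ⊎ length (proj₁ (reduceOnce P S)) + suc n ≤ length V)
    reduct-once {S} {n} r progress with filter (reducible? P (proj₂ S)) (proj₁ S) in eq
    ... | []    = r , inj₁ eq
    ... | v ∷ _ with v∈ , red ← ∈-filter⁻ (reducible? P (proj₂ S)) {xs = proj₁ S} (subst (v ∈_) (sym eq) (here refl)) =
      reduct-contract r v∈ (contractible (valid r) v∈ red) , inj₂ (shrink progress)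
      where
      shrink : _ ⊎ length (proj₁ S) + n ≤ length V → length (filter (λ x → ¬? (x ≟ v)) (proj₁ S)) + suc n ≤ length V
      shrink (inj₁ ())
      shrink (inj₂ ≤V) = ≤-trans (≤-reflexive (+-suc _ n)) (≤-trans
        (+-monoˡ-≤ n (filter-notAll (λ x → ¬? (x ≟ v)) (proj₁ S) (lose v∈ (λ v≢v → v≢v refl)))) ≤V)

    reduct : Reduct (reduce P (V , E)) × Irreducible (reduce P (V , E))
    reduct = proj₁ (iterate V) , finished (reduce P (V , E)) (proj₂ (iterate V))
      where
      iterate : ∀ L → let S = foldr (λ _ → reduceOnce P) (V , E) L in
                Reduct S × (Irreducible S ⊎ length (proj₁ S) + length L ≤ length V)
      iterate []      = record { valid = G ; ⊆V = λ x∈ → x∈ ; equiv = λ _ _ → mk⇔ (λ x → x) (λ x → x) } ,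
                        inj₂ (≤-reflexive (+-identityʳ _))
      iterate (_ ∷ L) = reduct-once (proj₁ (iterate L)) (proj₂ (iterate L))
      finished : ∀ S → Irreducible S ⊎ length (proj₁ S) + length V ≤ length V → Irreducible S
      finished _            (inj₁ irr) = irr
      finished ([] , _)     (inj₂ _)  = refl
      finished (_ ∷ V′ , _) (inj₂ ≤V) = contradiction (≤-trans (s≤s (m≤n+m (length V) (length V′))) ≤V) (<-irrefl refl)

    record Kernel (r : (List Vertex × List Edge) × List Vertex) : Set where
      field
        set-unique : Unique (proj₂ r)
        kernel-valid : Valid B (finSet (proj₂ r) set-unique) (proj₁ r)
        kernel-equiv : EquivalentTo kernel-valid
        kernel-count : length (proj₁ (proj₁ r)) ≤ 3 * (∣ B ∣ + ∣ X ∣) + 3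

    no-instance : ∀ {S w₁ w₂ ws} → Reduct S → Irreducible S → surplus P (proj₁ S) ≡ w₁ ∷ w₂ ∷ ws →
                  Kernel ((w₁ ∷ w₂ ∷ elements B , []) , w₁ ∷ w₂ ∷ elements B)
    no-instance {S} {w₁} {w₂} {ws} r irr eq = record
      { set-unique   = U
      ; kernel-valid = NO
      -- The two sides agree because neither gluing is ever a yes-instance.
      ; kernel-equiv = λ H glu → mk⇔ (λ π → ⊥-elim (G-no H glu π)) (λ π → ⊥-elim (NO-no H glu π))
      ; kernel-count = ≤-trans (m≤m+n (2 + ∣ B ∣) _) (≤-reflexive (lemma ∣ B ∣ ∣ X ∣))
      }
      where
      N = outside P (proj₁ S)
      lemma : ∀ b x → 2 + b + (1 + 2 * b + 3 * x) ≡ 3 * (b + x) + 3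
      lemma = solve-∀
      N⁻ : ∀ {x} → x ∈ w₁ ∷ w₂ ∷ ws → x ∈ proj₁ S × x ∉ P
      N⁻ {x} x∈ = ∈-filter⁻ (λ v → ¬? (v ∈? P)) (∈-drop (2 + 2 * length P) N
        (subst (x ∈_) (trans (sym eq) (surplus≡ P (proj₁ S))) x∈))
      ∉B : ∀ {x} → x ∈ w₁ ∷ w₂ ∷ ws → x ∉ˢ B
      ∉B x∈ x∈B = proj₂ (N⁻ x∈) (∈-++⁺ʳ (elements X) x∈B)
      w₁≢w₂ : w₁ ≢ w₂
      w₁≢w₂ with (≢ ∷ _) ∷ _ ← subst Unique (trans (sym (surplus≡ P (proj₁ S))) eq)
        (Unique.drop⁺ (2 + 2 * length P) (Unique.filter⁺ (λ v → ¬? (v ∈? P)) (uniqueᵛ (valid r)))) = ≢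
      U : Unique (w₁ ∷ w₂ ∷ elements B)
      U = (w₁≢w₂ ∷ All.tabulate (λ { x∈ refl → ∉B (here refl) x∈ })) ∷
          All.tabulate (λ { x∈ refl → ∉B (there (here refl)) x∈ }) ∷ distinct B
      NO : Valid B (finSet (w₁ ∷ w₂ ∷ elements B) U) (w₁ ∷ w₂ ∷ elements B , [])
      NO = record
        { uniqueᵛ = U ; endpointsᵛ = [] ; looplessᵛ = [] ; onceᵛ = []
        ; boundaryᵛ = λ x∈ → there (there x∈) ; subsetᵛ = λ x∈ → x∈ ; degreeTwoᵛ = λ x∈ x∉ → contradiction x∈ x∉ }
      module _ (H : Graph) (glu : ∀ {x} → x ∈ V → x ∈ˢ vertices H → x ∈ˢ B) where
        many-outside : ¬ length N ≤ 2 * length P + 3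
        many-outside N≤ = contradiction (begin
          2                               ≤⟨ s≤s (s≤s z≤n) ⟩
          length (w₁ ∷ w₂ ∷ ws)           ≡⟨ cong length eq ⟨
          length (surplus P (proj₁ S))    ≡⟨ length-surplus P (proj₁ S) ⟩
          length N ∸ (2 + 2 * length P)   ≤⟨ ∸-monoˡ-≤ (2 + 2 * length P) N≤ ⟩
          2 * length P + 3 ∸ (2 + 2 * length P) ≡⟨ cong (_∸ (2 + 2 * length P)) (+-comm (2 * length P) 3) ⟩
          1 + (2 + 2 * length P) ∸ (2 + 2 * length P) ≡⟨ m+n∸n≡m 1 (2 + 2 * length P) ⟩
          1                               ∎) λ { (s≤s ()) }
          where open ≤-Reasoning
        G-no : ¬ Π (graph (boundaried G) ∪ᵍ H)
        G-no π = many-outside (few-outside (valid r) irr H (glu ∘ ⊆V r) (Π⇒path _ (Equivalence.to (equiv r H glu) π)))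
        NO-no : ¬ Π (graph (boundaried NO) ∪ᵍ H)
        NO-no π with p , p↭ , l ← Π⇒path _ π
          with z , w₁-z ← has-neighbour Adj-sym l (∈-resp-↭ (↭-sym p↭) (here refl))
                                    (∈-resp-↭ (↭-sym p↭) (there (here refl))) w₁≢w₂
          with adjacent-∪⁻ (graph (boundaried NO)) H w₁-z
        -- The kernel itself has no edges, so an edge at `w₁` would come from `H`; but `w₁` is a
        -- vertex of `V` outside `B` and cannot lie in `H`.
        ... | inj₂ adj = ∉B (here refl) (glu (⊆V r (proj₁ (N⁻ (here refl)))) (adjacent-∈ H adj))

    -- The factor three is one for the vertices in `P` and two for the outside vertices. The length
    -- of `P` counts the common elements of `X` and `B` twice, which the upper bound permits.
    keep-instance : ∀ {S} → Reduct S → length (surplus P (proj₁ S)) ≤ 1 → Kernel (S , elements X)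
    keep-instance {S} r ≤1 = record
      { set-unique   = distinct X
      ; kernel-valid = valid r
      ; kernel-equiv = equiv r
      ; kernel-count = begin
          length (proj₁ S)                            ≤⟨ unique-length (uniqueᵛ (valid r)) cover ⟩
          length (P ++ N)                             ≡⟨ length-++ P ⟩
          length P + length N                         ≤⟨ +-monoʳ-≤ (length P) N≤ ⟩
          length P + (2 * length P + 3)               ≡⟨ cong (λ n → n + (2 * n + 3)) (length-++ (elements X)) ⟩
          ∣ X ∣ + ∣ B ∣ + (2 * (∣ X ∣ + ∣ B ∣) + 3)   ≡⟨ lemma ∣ B ∣ ∣ X ∣ ⟩
          3 * (∣ B ∣ + ∣ X ∣) + 3                     ∎
      }
      where
      open ≤-Reasoning
      N = outside P (proj₁ S)
      lemma : ∀ b x → x + b + (2 * (x + b) + 3) ≡ 3 * (b + x) + 3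
      lemma = solve-∀
      cover : ∀ {x} → x ∈ proj₁ S → x ∈ P ++ N
      cover {x} x∈ with x ∈? P
      ... | yes x∈P = ∈-++⁺ˡ x∈P
      ... | no x∉P  = ∈-++⁺ʳ P (∈-filter⁺ (λ v → ¬? (v ∈? P)) x∈ x∉P)
      N≤ : length N ≤ 2 * length P + 3
      N≤ = begin
        length N                                            ≤⟨ m≤n+m∸n (length N) (2 + 2 * length P) ⟩
        2 + 2 * length P + (length N ∸ (2 + 2 * length P))  ≡⟨ cong (2 + 2 * length P +_) (length-surplus P (proj₁ S)) ⟨
        2 + 2 * length P + length (surplus P (proj₁ S))     ≤⟨ +-monoʳ-≤ (2 + 2 * length P) ≤1 ⟩
        2 + 2 * length P + 1                                ≡⟨ lemma′ (2 * length P) ⟩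
        2 * length P + 3                                    ∎
        where
        lemma′ : ∀ n → 2 + n + 1 ≡ n + 3
        lemma′ = solve-∀

    -- A surplus of two means at least 2 |P| + 4 outside vertices, one more than `few-outside`
    -- allows in a yes-instance, and it also provides the two names for the negative kernel. A
    -- surplus of at most one means at most 2 |P| + 3 of them.
    kernel-correct : Kernel (finish (elements B) (elements X) (reduce P (V , E)))
    kernel-correct with r , irr ← reduct with surplus P (proj₁ (reduce P (V , E))) in eq
    ... | []           = keep-instance r (≤-trans (≤-reflexive (cong length eq)) z≤n)
    ... | _ ∷ []       = keep-instance r (≤-reflexive (cong length eq))
    ... | w₁ ∷ w₂ ∷ ws = no-instance r irr eq

-- Size bounds

length-cartesianProduct : ∀ {A B : Set} (xs : List A) (ys : List B) →
                          length (cartesianProduct xs ys) ≡ length xs * length ys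
length-cartesianProduct []       ys = refl
length-cartesianProduct (x ∷ xs) ys = trans (length-++ (map (x ,_) ys))
  (cong₂ _+_ (length-map (x ,_) ys) (length-cartesianProduct xs ys))

edges≤ : ∀ G → length (edges G) ≤ ∣ vertices G ∣ * ∣ vertices G ∣
edges≤ G = ≤-trans
  (unique-length (AllPairs.map (λ e≉f e≡f → e≉f (inj₁ e≡f)) (once G))
    (λ e∈ → let p , q = All.lookup (endpoints G) e∈ in ∈-cartesianProduct⁺ p q))
  (≤-reflexive (length-cartesianProduct (elements (vertices G)) _))

n≤2^n : ∀ n → n ≤ 2 ^ n
n≤2^n zero    = z≤n
n≤2^n (suc n) = ≤-trans (+-mono-≤ (m^n>0 2 n) (n≤2^n n)) (+-monoʳ-≤ (2 ^ n) (m≤m+n _ 0))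

⌈log₂⌉≤ : ∀ n → ⌈log₂ n ⌉ ≤ n
⌈log₂⌉≤ n = ≤-trans (⌈log₂⌉-mono-≤ (n≤2^n n)) (≤-reflexive (⌈log₂2^n⌉≡n n))

square : ℕ → ℕ
square n = n * n

-- This is (8 + n) ^ 8, built from squarings so that `squareᵖ` suffices for its computability. With
-- `m` vertices and the logarithm crudely bounded by `m`, the graph size is at most 2 (m + 1) ^ 3.
-- Since `L = square (8 + n)` is at least both 2 and m + 1, this is at most the fourth power of `L`.
sizeBound : ℕ → ℕ
sizeBound n = square (square (square (8 + n)))

abstract
  sizeBoundᵖ : Polytime unary unary sizeBound
  sizeBoundᵖ = squareᵖ ∘ᵖ squareᵖ ∘ᵖ squareᵖ ∘ᵖ
    sucᵖ (sucᵖ (sucᵖ (sucᵖ (sucᵖ (sucᵖ (sucᵖ (sucᵖ identity)))))))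

sizeBound-computable : Computable sizeBound
sizeBound-computable = program sizeBoundᵖ , λ n → steps sizeBoundᵖ n , run sizeBoundᵖ n

sizeBound-polynomial : PolynomiallyBounded sizeBound
sizeBound-polynomial = ≼⇒polynomiallyBounded sizeBound
  (square≼ (square≼ (square≼ (+-≼ (const-≼ 8) ≼-refl))))
  where
  square≼ : {f : ℕ → ℕ} → f ≼ (λ n → n) → square ∘ f ≼ (λ n → n)
  square≼ f≼ = *-≼ f≼ f≼

module _ {m n : ℕ} (m≤ : m ≤ 3 * n + 3) where

  private
    open ≤-Reasoning
    L = square (8 + n)

    m<L : suc m ≤ L
    m<L = begin
      suc m                                     ≤⟨ s≤s m≤ ⟩
      suc (3 * n + 3)                           ≤⟨ m≤m+n _ (60 + 13 * n + n * n) ⟩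
      suc (3 * n + 3) + (60 + 13 * n + n * n)   ≡⟨ lemma n ⟩
      L                                         ∎
      where
      lemma : ∀ n → suc (3 * n + 3) + (60 + 13 * n + n * n) ≡ (8 + n) * (8 + n)
      lemma = solve-∀

    1≤L : 1 ≤ L
    1≤L = ≤-trans (s≤s z≤n) m<L

  graph≤sizeBound : ∀ {e} → e ≤ m * m → (m + 2 * e) * (1 + ⌈log₂ m ⌉) ≤ sizeBound n
  graph≤sizeBound {e} e≤ = begin
    (m + 2 * e) * (1 + ⌈log₂ m ⌉) ≤⟨ *-mono-≤ (+-monoʳ-≤ m (*-monoʳ-≤ 2 e≤)) (s≤s (⌈log₂⌉≤ m)) ⟩
    (m + 2 * (m * m)) * suc m     ≤⟨ *-monoˡ-≤ (suc m) (m≤m+n (m + 2 * (m * m)) (3 * m + 2)) ⟩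
    (m + 2 * (m * m) + (3 * m + 2)) * suc m ≡⟨ lemma m ⟩
    2 * suc m * (suc m * suc m)   ≤⟨ *-mono-≤ (*-mono-≤ 2≤L m<L) (*-mono-≤ m<L m<L) ⟩
    L * L * (L * L)               ∎
    where
    2≤L : 2 ≤ L
    2≤L = *-mono-≤ {2} {8 + n} {1} {8 + n} (s≤s (s≤s z≤n)) (s≤s z≤n)
    lemma : ∀ m → (m + 2 * (m * m) + (3 * m + 2)) * suc m ≡ 2 * suc m * (suc m * suc m)
    lemma = solve-∀

  subset≤sizeBound : ∀ {s} → s ≤ m → s * (1 + ⌈log₂ m ⌉) ≤ sizeBound n
  subset≤sizeBound {s} s≤ = begin
    s * (1 + ⌈log₂ m ⌉) ≤⟨ *-mono-≤ (≤-trans s≤ (n≤1+n m)) (s≤s (⌈log₂⌉≤ m)) ⟩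
    suc m * suc m       ≤⟨ *-mono-≤ m<L m<L ⟩
    L * L               ≡⟨ *-identityʳ (L * L) ⟨
    L * L * (1 * 1)     ≤⟨ *-monoʳ-≤ (L * L) (*-mono-≤ 1≤L 1≤L) ⟩
    L * L * (L * L)     ∎

  value≤sizeBound : ∀ {s} → s ≤ m → s ≤ sizeBound n
  value≤sizeBound {s} s≤ = ≤-trans (≤-trans (≤-reflexive (sym (*-identityʳ s))) (*-monoʳ-≤ s (s≤s z≤n))) (subset≤sizeBound s≤)

-- Assembling the kernelizations

module _ (Π : Problem)
  (contract⇔ : ∀ {B X V E} (G : Valid B X (V , E)) {v} (v∈ : v ∈ V) (c : Contractible G v)
    (H : Graph) (glu : ∀ {x} → x ∈ V → x ∈ˢ vertices H → x ∈ˢ B) →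
    Π (graph (boundaried G) ∪ᵍ H) ⇔ Π (graph (boundaried (contract-valid G v∈ c)) ∪ᵍ H))
  (Π⇒path : ∀ G → Π G → HamPath G) where

  private
    input : ∀ {B} (G : Boundaried B) (s : DegreeTwoOutside (graph G)) →
            Valid B (set s) (elements (vertices (graph G)) , edges (graph G))
    input G s = record
      { uniqueᵛ    = distinct (vertices (graph G))
      ; endpointsᵛ = endpoints (graph G)
      ; looplessᵛ  = loopless (graph G)
      ; onceᵛ      = once (graph G)
      ; boundaryᵛ  = boundary G
      ; subsetᵛ    = subset s
      ; degreeTwoᵛ = degreeTwo s
      }

    module _ {B} (G : Boundaried B) (s : DegreeTwoOutside (graph G)) where
      open Kernel (kernel-correct Π contract⇔ Π⇒path (input G s)) public

  kernelization : BoundariedKernelization #v,deg≢2 Π sizeBound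
  kernelization = record
    { size-computable = sizeBound-computable
    ; algorithm       = program kernelᵖ
    -- The second summand pays for writing down the output.
    ; time            = λ n → (2 + n) ^ proj₁ (steps≼ kernelᵖ) + (2 + n) ^ proj₁ (size≼ kernelᵖ)
    ; time-polynomial = ≼⇒polynomiallyBounded _
        (+-≼ (proj₁ (steps≼ kernelᵖ) , λ _ → ≤-refl) (proj₁ (size≼ kernelᵖ) , λ _ → ≤-refl))
    ; output          = λ G s → boundaried (kernel-valid G s)
    ; solution        = λ G s → solutionSet (kernel-valid G s)
    ; computes        = λ {B} G s →
        let i = elements B , (elements (vertices (graph G)) , edges (graph G)) , elements (set s) in
        steps kernelᵖ i , run kernelᵖ i , +-mono-≤ (proj₂ (steps≼ kernelᵖ) i) (proj₂ (size≼ kernelᵖ) i)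
    ; equivalent      = λ G s H g _ → kernel-equiv G s (graph H) (λ x∈G x∈H → proj₁ (g x∈G x∈H))
    ; graph-bound     = λ G s → graph≤sizeBound (kernel-count G s) (edges≤ (graph (boundaried (kernel-valid G s))))
    ; solution-bound  = λ G s → subset≤sizeBound (kernel-count G s) (set≤ G s)
    ; value-bound     = λ G s → value≤sizeBound (kernel-count G s) (set≤ G s)
    }
    where
    set≤ : ∀ {B} (G : Boundaried B) s →
           ∣ set (solutionSet (kernel-valid G s)) ∣ ≤ ∣ vertices (graph (boundaried (kernel-valid G s))) ∣
    set≤ G s = unique-length (set-unique G s) (subsetᵛ (kernel-valid G s))

  kernelization-linear : LinearlyManyVertices #v,deg≢2 kernelization
  kernelization-linear = 3 , kernel-count

mainTheorem9 : (Σ[ f ∈ (ℕ → ℕ) ] Σ[ K ∈ BoundariedKernelization #v,deg≢2 HamiltonianCycle f ]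
    PolynomiallyBounded f × LinearlyManyVertices #v,deg≢2 K)
    ×
    (Σ[ f ∈ (ℕ → ℕ) ] Σ[ K ∈ BoundariedKernelization #v,deg≢2 HamiltonianPath f ]
    PolynomiallyBounded f × LinearlyManyVertices #v,deg≢2 K)
mainTheorem9 =
  (sizeBound , kernelization HamiltonianCycle contract-cycle cycle⇒path ,
    sizeBound-polynomial , kernelization-linear HamiltonianCycle contract-cycle cycle⇒path) ,
  (sizeBound , kernelization HamiltonianPath contract-path hamPath⁺ ,
    sizeBound-polynomial , kernelization-linear HamiltonianPath contract-path hamPath⁺)
  where
  cycle⇒path : ∀ G → HamiltonianCycle G → HamPath G
  cycle⇒path G (v , vs , p , l , _) = v ∷ vs , p , linked-init (v ∷ vs) l
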